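{- Let $G=(V,E)$ be a fullerene graph having a nontrivial cyclic $5$-edge cut. Then the number of perfect matchings of $G$ is at most $20^{\frac{|V|}{12}}$.
   Context: A fullerene graph is a planar cubic ($3$-regular) simple graph, embedded in the plane so that every face, including the unbounded one, is a pentagon or a hexagon (bounded by a cycle of length $5$ or $6$). A cyclic $5$-edge cut of $G$ is a set of $5$ edges whose removal separates $G$ into two components each of which contains a cycle; it is trivial if one of the two components is a single $5$-cycle, and nontrivial otherwise. -}

module Defs where

open import Data.Bool using (Bool; false; T; T?)
open import Data.Fin using (Fin; zero; suc; fromℕ; inject₁; toℕ)
import Data.Fin as Fin
open import Data.Fin.Properties using (all?)
open import Data.Fin.Subset using (Subset; inside; outside; _∈_; _∩_; ∣_∣)
open import Data.List using (List; []; _∷_; length; lookup; filter; allFin; cartesianProduct; cartesianProductWith)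
open import Data.Nat using (ℕ; zero; suc; _+_; _<_; _≟_)
open import Data.Nat.GeneralisedArithmetic using (iterate)
open import Data.Product using (Σ; ∃; _×_; _,_; proj₁; proj₂)
open import Data.Sum using (_⊎_)
import Data.Vec as Vec
open import Function.Bundles using (_⇔_)
open import Function.Definitions using (Injective)
open import Level using (0ℓ)
open import Relation.Binary.Core using (Rel)
open import Relation.Binary.Construct.Closure.ReflexiveTransitive using (Star)
open import Relation.Binary.PropositionalEquality using (_≡_; subst)
open import Relation.Nullary using (¬_; Dec; does)
open import Relation.Nullary.Decidable using (_×-dec_; _⊎-dec_)
open import Relation.Unary using (Decidable)

record Graph (n : ℕ) : Set where
  field
    adj        : Fin n → Fin n → Bool
    adj-sym    : ∀ u v → adj u v ≡ adj v u
    adj-irrefl : ∀ v → adj v v ≡ false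

-- A cycle of length k in the graph with adjacency R, listed as a closed walk
-- w 0, …, w k = w 0 whose first k vertices are distinct.
record IsCycle {n} (R : Rel (Fin n) 0ℓ) (k : ℕ) (w : Fin (suc k) → Fin n) : Set where
  field
    length≥3 : 2 < k
    closed   : w (fromℕ k) ≡ w zero
    steps    : ∀ (i : Fin k) → R (w (inject₁ i)) (w (suc i))
    distinct : Injective _≡_ _≡_ (λ (i : Fin k) → w (inject₁ i))

module _ {n} (G : Graph n) where
  open Graph G

  Adj : Rel (Fin n) 0ℓ
  Adj u v = T (adj u v)

  neighbours : Fin n → Subset n
  neighbours v = Vec.tabulate (adj v)

  Cubic : Set
  Cubic = ∀ v → ∣ neighbours v ∣ ≡ 3

  Connected : Set
  Connected = ∀ u v → Star Adj u v

  -- Each edge uv is listed exactly once, as the pair with u < v.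
  edges : List (Fin n × Fin n)
  edges = filter (λ (u , v) → (u Fin.<? v) ×-dec T? (adj u v))
                 (cartesianProduct (allFin n) (allFin n))

  EdgeIndex : Set
  EdgeIndex = Fin (length edges)

  EdgeSet : Set
  EdgeSet = Subset (length edges)

  Incident : Fin n → EdgeIndex → Set
  Incident v e = v ≡ proj₁ (lookup edges e) ⊎ v ≡ proj₂ (lookup edges e)

  incident? : ∀ v e → Dec (Incident v e)
  incident? v e = (v Fin.≟ proj₁ (lookup edges e)) ⊎-dec (v Fin.≟ proj₂ (lookup edges e))

  Joins : EdgeIndex → Fin n → Fin n → Set
  Joins e u v = lookup edges e ≡ (u , v) ⊎ lookup edges e ≡ (v , u)

  incidentEdges : Fin n → EdgeSet
  incidentEdges v = Vec.tabulate (λ e → does (incident? v e))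

  IsPerfectMatching : EdgeSet → Set
  IsPerfectMatching M = ∀ v → ∣ M ∩ incidentEdges v ∣ ≡ 1

  isPerfectMatching? : Decidable IsPerfectMatching
  isPerfectMatching? M = all? (λ v → ∣ M ∩ incidentEdges v ∣ ≟ 1)

subsets : ∀ m → List (Subset m)
subsets zero    = Vec.[] ∷ []
subsets (suc m) = cartesianProductWith Vec._∷_ (outside ∷ inside ∷ []) (subsets m)

numPerfectMatchings : ∀ {n} → Graph n → ℕ
numPerfectMatchings G = length (filter (isPerfectMatching? G) (subsets (length (edges G))))

record Dart {n} (G : Graph n) : Set where
  constructor dart
  field
    tail     : Fin n
    head     : Fin n
    adjacent : Adj G tail head

open Dart public

reverse : ∀ {n} {G : Graph n} → Dart G → Dart G
reverse {G = G} (dart u v a) = dart v u (subst T (Graph.adj-sym G u v) a)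

-- An embedding in the plane, up to homeomorphism and the choice of the
-- unbounded face, given as a combinatorial map (rotation system): `rotate`
-- sends each dart to the next one around its tail, and the face boundaries are
-- the orbits of `nextInFace`.  Euler's formula says that the surface is a sphere.
-- Only connected graphs are covered; this loses nothing when every face is
-- bounded by a single cycle, which forces connectedness.
record PlaneEmbedding {n} (G : Graph n) : Set where
  field
    connected     : Connected G
    rotate        : Dart G → Dart G
    rotate-tail   : ∀ d → tail (rotate d) ≡ tail d
    -- By finiteness, this makes `rotate` a cyclic permutation of the darts at
    -- each vertex.
    rotate-cyclic : ∀ d d′ → tail d ≡ tail d′ → ∃ λ k → iterate rotate d k ≡ d′

  nextInFace : Dart G → Dart G
  nextInFace d = rotate (reverse d)

  field
    numFaces    : ℕ
    face        : Dart G → Fin numFaces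
    face-onto   : ∀ f → ∃ λ d → face d ≡ f
    face-orbits : ∀ d d′ → face d ≡ face d′ ⇔ (∃ λ k → iterate nextInFace d k ≡ d′)
    euler       : n + numFaces ≡ length (edges G) + 2

  FaceBoundedByCycle : ℕ → Dart G → Set
  FaceBoundedByCycle k d =
    iterate nextInFace d k ≡ d ×
    IsCycle (Adj G) k (λ i → tail (iterate nextInFace d (toℕ i)))

IsFullerene : ∀ {n} → Graph n → Set
IsFullerene G =
  Cubic G ×
  Σ (PlaneEmbedding G) λ E → let open PlaneEmbedding E in
    ∀ d → FaceBoundedByCycle 5 d ⊎ FaceBoundedByCycle 6 d

module _ {n} (G : Graph n) where

  RemoveEdges : EdgeSet G → Rel (Fin n) 0ℓ
  RemoveEdges S u v = Adj G u v × ¬ (∃ λ e → e ∈ S × Joins G e u v)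

  -- The components of G − S are exactly the two classes of `component`; both
  -- classes are nonempty because each contains a cycle.
  record IsCyclic5EdgeCut (S : EdgeSet G) : Set where
    field
      size       : ∣ S ∣ ≡ 5
      component  : Fin n → Fin 2
      components : ∀ u v → component u ≡ component v ⇔ Star (RemoveEdges S) u v
      cyclic     : ∀ c → ∃ λ k → Σ (Fin (suc k) → Fin n) λ w →
                     IsCycle (RemoveEdges S) k w × (∀ i → component (w i) ≡ c)

  module _ {S : EdgeSet G} (cut : IsCyclic5EdgeCut S) where
    open IsCyclic5EdgeCut cut

    -- Component c consists of the vertices and edges of a 5-cycle and nothing else.
    ComponentIs5Cycle : Fin 2 → Set
    ComponentIs5Cycle c = Σ (Fin 6 → Fin n) λ w →
      IsCycle (RemoveEdges S) 5 w ×
      (∀ v → component v ≡ c ⇔ (∃ λ i → w i ≡ v)) ×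
      (∀ u v → component u ≡ c → RemoveEdges S u v →
        ∃ λ (i : Fin 5) → (w (inject₁ i) ≡ u × w (suc i) ≡ v) ⊎
                          (w (inject₁ i) ≡ v × w (suc i) ≡ u))

    Trivial : Set
    Trivial = ∃ λ c → ComponentIs5Cycle c

  IsNontrivialCyclic5EdgeCut : EdgeSet G → Set
  IsNontrivialCyclic5EdgeCut S = Σ (IsCyclic5EdgeCut S) λ cut → ¬ Trivial cut

{-# OPTIONS --safe #-}
module Submission where

-- Fullerenes have no cycles of length 3 or 4.  A 4-cycle would turn left twice and right twice
-- (three equal turns would close up a face), and following the faces on its two sides shows that
-- they are hexagons and that all neighbours of the cycle lie on 4-cycles again.  By connectedness
-- all faces are hexagons, contrary to Euler's formula.
--
-- In a connected cubic graph without 3- and 4-cycles, proper induced subgraphs with s vertices and degree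
-- sum e have at most (8/9)^s (71/63)^e perfect matchings: branch on the partner of a vertex of
-- least degree; the missing short cycles guarantee that enough edges disappear.  A whole
-- cubic graph loses a constant factor in its first, threefold branching, which is absorbed
-- because (8/9)(71/63)³ < 20^(1/12) and a fullerene has at least 20 vertices.

open import Defs
open import Data.Nat using (ℕ; _≤_; _^_)
open import Data.Product using (∃)
open import Data.Bool using (Bool; true; false; T; T?)
open import Data.Bool.Properties using (T-irrelevant; T-≡)
open import Data.Empty using (⊥; ⊥-elim)
open import Data.Fin using (Fin; zero; suc; toℕ; cast; combine; remQuot; inject₁; fromℕ<)
import Data.Fin as Fin
open import Data.Fin.Patterns using (0F; 1F; 2F; 3F; 4F)
open import Data.Fin.Properties
  using (all?; any?; suc-injective; toℕ-injective; toℕ-inject₁; inject₁-injective;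
         toℕ-cast; cast-involutive; injective⇒≤; combine-injective; combine-remQuot)
open import Data.Fin.Subset using (Subset; inside; outside; _∈_; _∩_; ∣_∣)
open import Data.Fin.Subset.Properties using (_∈?_; x∈p∩q⁺; x∈p∩q⁻; ⊆-antisym)
open import Data.List using (List; []; _∷_; length; lookup; filter; allFin; cartesianProduct)
open import Data.List.Membership.Propositional using () renaming (_∈_ to _∈ₗ_)
open import Data.List.Membership.Propositional.Properties
  using (∈-filter⁺; ∈-filter⁻; ∈-cartesianProduct⁺; ∈-allFin; ∈-lookup)
import Data.List.Relation.Unary.All as All
open import Data.List.Relation.Unary.All using ([]; _∷_)
open import Data.List.Relation.Unary.AllPairs using ([]; _∷_)
open import Data.List.Relation.Unary.Any using (here; there; index)
open import Data.List.Relation.Unary.Any.Properties using (lookup-index)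
open import Data.List.Relation.Unary.Unique.Propositional using (Unique)
open import Data.List.Relation.Unary.Unique.Propositional.Properties
  using (cartesianProduct⁺; cartesianProductWith⁺; allFin⁺) renaming (filter⁺ to Unique-filter⁺)
open import Data.Nat using (zero; suc; _+_; _*_; _<_; z≤n; s≤s; NonZero)
open import Data.Nat.GeneralisedArithmetic using (iterate)
open import Data.Nat.Induction using (<-wellFounded)
import Data.Nat.Properties as ℕₚ
open import Data.Nat.Tactic.RingSolver using (solve-∀)
open import Data.Product using (_×_; _,_; proj₁; proj₂; swap)
import Data.Sum as Sum
open import Data.Sum using (_⊎_; inj₁; inj₂; [_,_]′)
import Data.Vec as Vec
open import Data.Vec using ([]; _∷_; here; there)
open import Data.Vec.Properties using ([]=⇒lookup; lookup⇒[]=; lookup∘tabulate; ∷-injective)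
open import Function using (_∘_; case_of_)
open import Function.Bundles using (Equivalence)
open import Function.Definitions using (Injective)
open import Induction.WellFounded using (Acc; acc)
open import Level using (0ℓ)
open import Relation.Binary.Construct.Closure.ReflexiveTransitive using (Star; ε; _◅_)
open import Relation.Binary.Definitions using (tri<; tri≈; tri>)
open import Relation.Binary.PropositionalEquality
open import Relation.Nullary using (¬_; Dec; yes; no; does; contradiction)
open import Relation.Nullary.Decidable using (toWitness; _×-dec_; _⊎-dec_; _→-dec_; ¬?)
open import Relation.Unary using (Pred; Decidable)
open import Algebra.Properties.CommutativeMonoid.Sum ℕₚ.+-0-commutativeMonoid
  using (sum; sum-cong-≗; ∑-distrib-+; sum-replicate-zero)

-- Enumerating finite subsets

-- Write `a = 8/9` and `b = 71/63`. Two constraints fix these numbers. An edge forced at a vertex of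
-- degree 1 removes two vertices but is only sure to lower the degree sum by 2, so `ab >= 1` is
-- needed; indeed `8 * 71 = 568` and `9 * 63 = 567`. If a vertex of degree 2 has one neighbour of
-- degree 2 and one of degree 3, the two branches shrink the bound by `x = a^2 b^6` and by `x^2`, so
-- `1/x + 1/x^2 <= 1` is needed. With equality in both, `b^4` would be the golden ratio; the chosen
-- fractions satisfy both with little to spare. The rate `a b^3` for a cubic graph is then about
-- 1.2723, against 1.2836 for `20^(1/12)`. Branching where all degrees are 3 costs a factor
-- `3/(a^2 b^10)`, about 1.149. Connectedness confines it to the start: in a nonempty proper induced
-- subgraph some vertex has lost a neighbour.

enum : ∀ {n} (p : Subset n) → Fin ∣ p ∣ → Fin n
enum (outside ∷ p) i       = suc (enum p i)
enum (inside  ∷ p) zero    = zero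
enum (inside  ∷ p) (suc i) = suc (enum p i)

enum-injective : ∀ {n} (p : Subset n) → Injective _≡_ _≡_ (enum p)
enum-injective (outside ∷ p) eq = enum-injective p (suc-injective eq)
enum-injective (inside ∷ p) {zero}  {zero}  eq = refl
enum-injective (inside ∷ p) {suc i} {suc j} eq = cong suc (enum-injective p (suc-injective eq))

enum-∈ : ∀ {n} (p : Subset n) i → enum p i ∈ p
enum-∈ (outside ∷ p) i       = there (enum-∈ p i)
enum-∈ (inside  ∷ p) zero    = here
enum-∈ (inside  ∷ p) (suc i) = there (enum-∈ p i)

enum-surjective : ∀ {n} (p : Subset n) {x} → x ∈ p → ∃ λ i → enum p i ≡ x
enum-surjective (inside  ∷ p) here      = zero , refl
enum-surjective (outside ∷ p) (there m) with i , eq ← enum-surjective p m = i , cong suc eq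
enum-surjective (inside  ∷ p) (there m) with i , eq ← enum-surjective p m = suc i , cong suc eq

∈-tabulate⁺ : ∀ {n} (f : Fin n → Bool) {x} → T (f x) → x ∈ Vec.tabulate f
∈-tabulate⁺ f {x} t = lookup⇒[]= x _ (trans (lookup∘tabulate f x) (Equivalence.to T-≡ t))

∈-tabulate⁻ : ∀ {n} (f : Fin n → Bool) {x} → x ∈ Vec.tabulate f → T (f x)
∈-tabulate⁻ f {x} m = Equivalence.from T-≡ (trans (sym (lookup∘tabulate f x)) ([]=⇒lookup m))

abstract
  third : ∀ (a b : Fin 3) → ∃ λ c → c ≢ a × c ≢ b
  third = toWitness {a? = all? λ a → all? λ b → any? λ c → ¬? (c Fin.≟ a) ×-dec ¬? (c Fin.≟ b)} _

  oneOfThree : ∀ (a b c x : Fin 3) → a ≢ b → b ≢ c → a ≢ c → x ≡ a ⊎ x ≡ b ⊎ x ≡ c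
  oneOfThree = toWitness {a? = all? λ a → all? λ b → all? λ c → all? λ x →
    ¬? (a Fin.≟ b) →-dec (¬? (b Fin.≟ c) →-dec (¬? (a Fin.≟ c) →-dec
      ((x Fin.≟ a) ⊎-dec ((x Fin.≟ b) ⊎-dec (x Fin.≟ c)))))} _

-- Short cycles, darts and their reversal

module Graphs {n} (G : Graph n) where
  open Graph G

  Adj-sym : ∀ {u v} → Adj G u v → Adj G v u
  Adj-sym {u} {v} = subst T (adj-sym u v)

  Adj-irrefl : ∀ {v} → ¬ Adj G v v
  Adj-irrefl {v} = subst T (adj-irrefl v)

  Adj⇒≢ : ∀ {u v} → Adj G u v → u ≢ v
  Adj⇒≢ a refl = Adj-irrefl a

  OnSquare : Fin n → Set
  OnSquare v = ∃ λ a → ∃ λ b → ∃ λ c →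
    Adj G v a × Adj G a b × Adj G b c × Adj G c v × v ≢ b × a ≢ c

  SquareFree : Set
  SquareFree = ∀ v → ¬ OnSquare v

  TriangleFree : Set
  TriangleFree = ∀ {u v w} → Adj G u v → Adj G v w → ¬ Adj G w u

  dart-≡ : {d e : Dart G} → tail d ≡ tail e → head d ≡ head e → d ≡ e
  dart-≡ {dart u v a} {dart .u .v b} refl refl = cong (dart u v) (T-irrelevant a b)

  -- Opaque because the normal form of a composite of reversals grows exponentially.
  opaque
    α : Dart G → Dart G
    α = reverse

    α-tail : ∀ d → tail (α d) ≡ head d
    α-tail d = refl

    α-head : ∀ d → head (α d) ≡ tail d
    α-head d = refl

    α-involutive : ∀ d → α (α d) ≡ d
    α-involutive d = dart-≡ refl refl

  edge-∈ : ∀ {u v} → u Fin.< v → Adj G u v → (u , v) ∈ₗ edges G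
  edge-∈ u<v a = ∈-filter⁺ _ (∈-cartesianProduct⁺ (∈-allFin _) (∈-allFin _)) (u<v , a)

-- Darts of a cubic graph and the handshake inequality

module CubicGraphs {n} (G : Graph n) (cubic : Cubic G) where
  open Graphs G public

  nb : Fin n → Fin 3 → Fin n
  nb v i = enum (neighbours G v) (cast (sym (cubic v)) i)

  nb-injective : ∀ v → Injective _≡_ _≡_ (nb v)
  nb-injective v {i} {j} eq = toℕ-injective (trans (sym (toℕ-cast _ i))
    (trans (cong toℕ (enum-injective (neighbours G v) eq)) (toℕ-cast _ j)))

  nb-adj : ∀ v i → Adj G v (nb v i)
  nb-adj v i = ∈-tabulate⁻ _ (enum-∈ (neighbours G v) _)

  nb-surjective : ∀ {v w} → Adj G v w → ∃ λ i → nb v i ≡ w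
  nb-surjective {v} a with i , eq ← enum-surjective (neighbours G v) (∈-tabulate⁺ _ a) =
    cast (cubic v) i , 
      trans (cong (enum (neighbours G v)) (cast-involutive (sym (cubic v)) (cubic v) i)) eq

  slot : Dart G → Fin 3
  slot d = proj₁ (nb-surjective (adjacent d))

  nb-slot : ∀ d → nb (tail d) (slot d) ≡ head d
  nb-slot d = proj₂ (nb-surjective (adjacent d))

  slot-injective : ∀ {d e} → tail d ≡ tail e → slot d ≡ slot e → d ≡ e
  slot-injective {d} {e} t s =
    dart-≡ t (trans (sym (nb-slot d)) (trans (cong₂ nb t s) (nb-slot e)))

  dartAt : Fin n → Fin 3 → Dart G
  dartAt v i = dart v (nb v i) (nb-adj v i)

  slot-dartAt : ∀ v i → slot (dartAt v i) ≡ i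
  slot-dartAt v i = nb-injective v (nb-slot (dartAt v i))

  dartCode : Dart G → Fin (n * 3)
  dartCode d = combine (tail d) (slot d)

  dartCode-injective : Injective _≡_ _≡_ dartCode
  dartCode-injective {d} {e} eq with t , s ← combine-injective (tail d) (slot d) (tail e) (slot e) eq =
    slot-injective t s

  -- `edges` stores only the increasing orientation of an edge; the second component restores the
  -- direction of a dart.
  ends : Fin (length (edges G)) × Fin 2 → Fin n × Fin n
  ends (e , 0F) = lookup (edges G) e
  ends (e , 1F) = swap (lookup (edges G) e)

  edgeOf : (d : Dart G) → ∃ λ e → ends e ≡ (tail d , head d)
  edgeOf (dart u v a) with ℕₚ.<-cmp (toℕ u) (toℕ v)
  ... | tri< u<v _ _ = (index (edge-∈ u<v a) , 0F) , sym (lookup-index (edge-∈ u<v a))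
  ... | tri≈ _ u≡v _ = ⊥-elim (Adj⇒≢ a (toℕ-injective u≡v))
  ... | tri> _ _ v<u = (index (edge-∈ v<u (Adj-sym a)) , 1F) ,
                       cong swap (sym (lookup-index (edge-∈ v<u (Adj-sym a))))

  edgeOf-injective : Injective _≡_ _≡_ (proj₁ ∘ edgeOf)
  edgeOf-injective {d} {e} eq
    with p ← trans (sym (proj₂ (edgeOf d))) (trans (cong ends eq) (proj₂ (edgeOf e))) =
    dart-≡ (cong proj₁ p) (cong proj₂ p)

  n*3≤edges*2 : n * 3 ≤ length (edges G) * 2
  n*3≤edges*2 = injective⇒≤ {f = code} inj
    where
    at : Fin (n * 3) → Dart G
    at x = let v , i = remQuot 3 x in dartAt v i
    code : Fin (n * 3) → Fin (length (edges G) * 2)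
    code x = let e , s = proj₁ (edgeOf (at x)) in combine e s
    inj : Injective _≡_ _≡_ code
    inj {x} {y} eq with e , s ← combine-injective _ _ _ _ eq
                   with d ← edgeOf-injective (cong₂ _,_ e s) =
      trans (sym (combine-remQuot {n} 3 x)) (trans (cong₂ combine (cong tail d)
        (trans (sym (slot-dartAt _ _)) (trans (cong slot d) (slot-dartAt _ _)))) (combine-remQuot {n} 3 y))

-- Rotations, turns and faces of a cubic plane graph

module Rotations {n} (G : Graph n) (cubic : Cubic G) (E : PlaneEmbedding G) where
  open CubicGraphs G cubic public
  open PlaneEmbedding E public

  thirdDart : ∀ d e → tail e ≡ tail d → ∃ λ f → tail d ≡ tail f × f ≢ d × f ≢ e
  thirdDart d e eq with i , i≢d , i≢e ← third (slot d) (slot e) =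
    dartAt (tail d) i , refl ,
    (λ { refl → i≢d (sym (slot-dartAt _ i)) }) , (λ { refl → i≢e (sym (slot-dartAt _ i)) })

  -- A fixed dart would be alone in its orbit, but `rotate-cyclic` must reach all three darts at the
  -- vertex.
  rotate≢ : ∀ d → rotate d ≢ d
  rotate≢ d fix with f , t , f≢d , _ ← thirdDart d d refl
                with k , eq ← rotate-cyclic d f t = f≢d (trans (sym eq) (stays k))
    where
    stays : ∀ k → iterate rotate d k ≡ d
    stays zero    = refl
    stays (suc k) = trans (cong (λ x → iterate rotate x k) fix) (stays k)

  rotate²≢ : ∀ d → rotate (rotate d) ≢ d
  rotate²≢ d fix with f , t , f≢d , f≢rd ← thirdDart d (rotate d) (rotate-tail d)
                 with k , eq ← rotate-cyclic d f t =
    [ (λ p → f≢d (trans (sym eq) p)) , (λ p → f≢rd (trans (sym eq) p)) ]′ (stays k)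
    where
    stays : ∀ k → iterate rotate d k ≡ d ⊎ iterate rotate d k ≡ rotate d
    stays zero          = inj₁ refl
    stays (suc zero)    = inj₂ refl
    stays (suc (suc k)) =
      subst (λ x → iterate rotate x k ≡ d ⊎ iterate rotate x k ≡ rotate d) (sym fix) (stays k)

  rotate-orbit : ∀ d e → tail e ≡ tail d → e ≡ d ⊎ e ≡ rotate d ⊎ e ≡ rotate (rotate d)
  rotate-orbit d e t
    with oneOfThree (slot d) (slot (rotate d)) (slot (rotate (rotate d))) (slot e)
      (λ p → rotate≢ d (sym (slot-injective (sym (rotate-tail d)) p)))
      (λ p → rotate≢ (rotate d) (sym (slot-injective (sym (rotate-tail (rotate d))) p)))
      (λ p → rotate²≢ d (sym (slot-injective (sym (trans (rotate-tail _) (rotate-tail d))) p)))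
  ... | inj₁ p        = inj₁ (slot-injective t p)
  ... | inj₂ (inj₁ p) = inj₂ (inj₁ (slot-injective (trans t (sym (rotate-tail d))) p))
  ... | inj₂ (inj₂ p) =
    inj₂ (inj₂ (slot-injective (trans t (sym (trans (rotate-tail _) (rotate-tail d)))) p))

  -- The result is again one of the three darts at the vertex; the other two options would give
  -- `rotate` a fixed dart or an orbit of length 2.
  rotate³ : ∀ d → rotate (rotate (rotate d)) ≡ d
  rotate³ d with rotate-orbit d (rotate (rotate (rotate d)))
                   (trans (rotate-tail _) (trans (rotate-tail _) (rotate-tail d)))
  ... | inj₁ p        = p
  ... | inj₂ (inj₁ p) = contradiction p (rotate²≢ (rotate d))
  ... | inj₂ (inj₂ p) = contradiction p (rotate≢ (rotate (rotate d)))

  rotate-elim : ∀ (P : Dart G → Set) d → P d → P (rotate d) → P (rotate (rotate d)) →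
    ∀ e → tail e ≡ tail d → P e
  rotate-elim P d p₀ p₁ p₂ e t with rotate-orbit d e t
  ... | inj₁ refl        = p₀
  ... | inj₂ (inj₁ refl) = p₁
  ... | inj₂ (inj₂ refl) = p₂

  opaque
    unfolding α

    φ : Dart G → Dart G
    φ = nextInFace

    φ-def : ∀ d → φ d ≡ rotate (α d)
    φ-def d = refl

    face-φ : ∀ d → face (φ d) ≡ face d
    face-φ d = sym (Equivalence.from (face-orbits d (φ d)) (1 , refl))

    φ-closes : ∀ k d → FaceBoundedByCycle k d → iterate φ d k ≡ d
    φ-closes k d = proj₁

    φ-distinct : ∀ k d → FaceBoundedByCycle k d →
      Injective _≡_ _≡_ (λ (i : Fin k) → tail (iterate φ d (toℕ (inject₁ i))))
    φ-distinct k d (_ , c) = IsCycle.distinct c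

  φ-tail : ∀ d → tail (φ d) ≡ head d
  φ-tail d = trans (cong tail (φ-def d)) (trans (rotate-tail (α d)) (α-tail d))

  φ-adj : ∀ d → Adj G (tail d) (tail (φ d))
  φ-adj d = subst (Adj G (tail d)) (sym (φ-tail d)) (adjacent d)

  φ-α : ∀ d → φ (α d) ≡ rotate d
  φ-α d = trans (φ-def (α d)) (cong rotate (α-involutive d))

  -- A path d, e that does not backtrack leaves head d either along the face of d or along the
  -- face of α d.
  TurnL TurnR : Dart G → Dart G → Set
  TurnL d e = e ≡ φ d
  TurnR d e = e ≡ rotate (φ d)

  turn : ∀ d e → tail e ≡ head d → head e ≢ tail d → TurnL d e ⊎ TurnR d e
  turn d e t h with rotate-orbit (α d) e (trans t (sym (α-tail d)))
  ... | inj₁ refl     = contradiction (α-head d) h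
  ... | inj₂ (inj₁ p) = inj₁ (trans p (sym (φ-def d)))
  ... | inj₂ (inj₂ p) = inj₂ (trans p (cong rotate (sym (φ-def d))))

  -- Around the common vertex `e` comes one step after `α d`, hence `α d` comes two steps after `e`:
  -- reversal exchanges left and right.
  reverseL : ∀ {d e} → TurnL d e → TurnR (α e) (α d)
  reverseL {d} refl = sym (trans (cong rotate (trans (φ-α (φ d)) (cong rotate (φ-def d)))) (rotate³ (α d)))

  reverseR : ∀ {d e} → TurnR d e → TurnL (α e) (α d)
  reverseR {d} refl =
    sym (trans (φ-α (rotate (φ d))) (trans (cong (rotate ∘ rotate) (φ-def d)) (rotate³ (α d))))

  face-iterate : ∀ d k → face (iterate φ d k) ≡ face d
  face-iterate d zero    = refl
  face-iterate d (suc k) = trans (face-iterate (φ d) k) (face-φ d)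

  -- Taking `k` darts from each face gives distinct darts, within a face by hypothesis and between
  -- faces by `face`; there are at most `n * 3` codes for them.
  numFaces*k≤n*3 : ∀ k → (∀ d → Injective _≡_ _≡_ (λ (i : Fin k) → iterate φ d (toℕ i))) →
    numFaces * k ≤ n * 3
  numFaces*k≤n*3 k distinct = injective⇒≤ {f = dartCode ∘ at} (inj ∘ dartCode-injective)
    where
    rep : Fin numFaces → Dart G
    rep f = proj₁ (face-onto f)
    at : Fin (numFaces * k) → Dart G
    at x = let f , i = remQuot {numFaces} k x in iterate φ (rep f) (toℕ i)
    face-at : ∀ x → face (at x) ≡ proj₁ (remQuot {numFaces} k x)
    face-at x = let f , i = remQuot {numFaces} k x in
      trans (face-iterate (rep f) (toℕ i)) (proj₂ (face-onto f))
    at-injective : ∀ {f g i j} → iterate φ (rep f) (toℕ i) ≡ iterate φ (rep g) (toℕ j) → f ≡ g →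
      combine f i ≡ combine {numFaces} {k} g j
    at-injective {f} eq refl = cong (combine f) (distinct (rep f) eq)
    inj : Injective _≡_ _≡_ at
    inj {x} {y} eq = trans (sym (combine-remQuot {numFaces} k x)) (trans
      (at-injective eq (trans (sym (face-at x)) (trans (cong face eq) (face-at y))))
      (combine-remQuot {numFaces} k y))

-- Fullerenes have no short cycles and at least 20 vertices

module Fullerenes {n} (G : Graph n) (cubic : Cubic G) (E : PlaneEmbedding G)
  (bounded : ∀ d → PlaneEmbedding.FaceBoundedByCycle E 5 d ⊎ PlaneEmbedding.FaceBoundedByCycle E 6 d)
  where
  open Rotations G cubic E public

  -- This does exclude pentagons: periods 5 and 6 together would give `φ d ≡ d`, a loop.
  Hexagonal : Dart G → Set
  Hexagonal d = iterate φ d 6 ≡ d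

  Hexagonal-φ : ∀ {d} → Hexagonal d → Hexagonal (φ d)
  Hexagonal-φ = cong φ

  pentagonOrHexagon : ∀ d → iterate φ d 5 ≡ d ⊎ Hexagonal d
  pentagonOrHexagon d = Sum.map (φ-closes 5 d) (φ-closes 6 d) (bounded d)

  φ²≢ : ∀ d → tail (iterate φ d 2) ≢ tail d
  φ²≢ d eq = [ (λ b → case φ-distinct 5 d b {2F} {0F} eq of λ ()) ,
                (λ b → case φ-distinct 6 d b {2F} {0F} eq of λ ()) ]′ (bounded d)

  φ³≢ : ∀ d → tail (iterate φ d 3) ≢ tail d
  φ³≢ d eq = [ (λ b → case φ-distinct 5 d b {3F} {0F} eq of λ ()) ,
                (λ b → case φ-distinct 6 d b {3F} {0F} eq of λ ()) ]′ (bounded d)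

  φ⁴≢ : ∀ d → tail (iterate φ d 4) ≢ tail d
  φ⁴≢ d eq = [ (λ b → case φ-distinct 5 d b {4F} {0F} eq of λ ()) ,
                (λ b → case φ-distinct 6 d b {4F} {0F} eq of λ ()) ]′ (bounded d)

  -- Two of the three turns go the same way, so a face follows all three sides and returns to a
  -- vertex after three steps.
  triangle-free : TriangleFree
  triangle-free {u} {v} {w} uv vw wu =
    cases (turn D₀ D₁ refl (Adj⇒≢ wu)) (turn D₁ D₂ refl (Adj⇒≢ uv)) (turn D₂ D₀ refl (Adj⇒≢ vw))
    where
    D₀ = dart u v uv
    D₁ = dart v w vw
    D₂ = dart w u wu
    left : ∀ {d e f} → TurnL d e → TurnL e f → head f ≢ tail d
    left {d} refl refl h = φ³≢ d (trans (φ-tail _) h)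
    right : ∀ {d e f} → TurnR d e → TurnR e f → head f ≢ tail d
    right {d} {e} {f} p q h = left (reverseR q) (reverseR p)
      (trans (α-head d) (trans (sym h) (sym (α-tail f))))
    cases : TurnL D₀ D₁ ⊎ TurnR D₀ D₁ → TurnL D₁ D₂ ⊎ TurnR D₁ D₂ →
      TurnL D₂ D₀ ⊎ TurnR D₂ D₀ → ⊥
    cases (inj₁ p) (inj₁ q) _        = left p q refl
    cases (inj₁ p) (inj₂ q) (inj₁ r) = left r p refl
    cases (inj₁ p) (inj₂ q) (inj₂ r) = right q r refl
    cases (inj₂ p) (inj₁ q) (inj₁ r) = left q r refl
    cases (inj₂ p) (inj₁ q) (inj₂ r) = right r p refl
    cases (inj₂ p) (inj₂ q) _        = right p q refl

  -- The edges `e₁` and `e₂` leave the 4-cycle on its left, and the faces of `g` and `h` meet along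
  -- both. If both faces are pentagons, `φ e₁` and `φ e₂` are the same edge and its end has degree
  -- 2. A pentagon and a hexagon yield a triangle. Two hexagons yield a 4-cycle through the far ends
  -- of `e₁` and `e₂`.
  alternating : ∀ {d₀ d₁ d₂ d₃} →
    TurnL d₀ d₁ → TurnR d₁ d₂ → TurnL d₂ d₃ → TurnR d₃ d₀ →
    Hexagonal d₀ × OnSquare (head (φ d₁))
  alternating {d₀} {d₁} {d₂} {d₃} refl refl refl p₀ =
    cases (pentagonOrHexagon g) (pentagonOrHexagon h)
    where
    e₁ = φ d₁
    e₂ = φ d₃
    g = α e₂
    h = α e₁
    φg : φ g ≡ d₀
    φg = trans (φ-α e₂) (sym p₀)
    φh : φ h ≡ d₂
    φh = φ-α e₁
    tail-g : tail g ≡ tail (φ e₂)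
    tail-g = trans (α-tail e₂) (sym (φ-tail e₂))
    tail-h : tail h ≡ tail (φ e₁)
    tail-h = trans (α-tail e₁) (sym (φ-tail e₁))
    from-g : ∀ k → iterate φ g (suc k) ≡ iterate φ d₀ k
    from-g k = cong (λ d → iterate φ d k) φg
    from-h : ∀ k → iterate φ h (suc k) ≡ iterate φ d₂ k
    from-h k = cong (λ d → iterate φ d k) φh
    cases : iterate φ g 5 ≡ g ⊎ Hexagonal g → iterate φ h 5 ≡ h ⊎ Hexagonal h →
      Hexagonal d₀ × OnSquare (head e₁)
    cases (inj₁ a) (inj₁ b) = contradiction
      (trans (cong rotate (sym (trans opposite (φ-def e₂)))) (trans (sym (φ-def (φ e₁))) a′))
      (rotate²≢ g)
      where
      a′ : φ (φ e₁) ≡ g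
      a′ = trans (sym (from-g 4)) a
      b′ : φ (φ e₂) ≡ h
      b′ = trans (sym (from-h 4)) b
      opposite : α (φ e₁) ≡ φ e₂
      opposite = dart-≡
        (trans (α-tail _) (trans (sym (φ-tail _)) (trans (cong tail a′) tail-g)))
        (trans (α-head _) (trans (sym tail-h) (trans (cong tail (sym b′)) (φ-tail _))))
    cases (inj₁ a) (inj₂ b) = ⊥-elim (triangle-free
      (subst (Adj G _) (trans (cong tail (trans (sym (from-g 4)) a)) tail-g) (φ-adj (φ e₁)))
      (φ-adj (φ e₂))
      (subst (Adj G _) (trans (cong tail (trans (sym (from-h 5)) b)) tail-h) (φ-adj (φ (φ e₂)))))
    cases (inj₂ a) (inj₁ b) = ⊥-elim (triangle-free
      (subst (Adj G _) (trans (cong tail (trans (sym (from-h 4)) b)) tail-h) (φ-adj (φ e₂)))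
      (φ-adj (φ e₁))
      (subst (Adj G _) (trans (cong tail (trans (sym (from-g 5)) a)) tail-g) (φ-adj (φ (φ e₁)))))
    cases (inj₂ a) (inj₂ b) =
      subst Hexagonal φg (Hexagonal-φ {g} a) ,
      subst OnSquare (φ-tail e₁) (
        tail (φ (φ e₁)) , tail (φ e₂) , tail (φ (φ e₂)) ,
        φ-adj (φ e₁) ,
        subst (Adj G _) (trans (cong tail (trans (sym (from-g 5)) a)) tail-g) (φ-adj (φ (φ e₁))) ,
        φ-adj (φ e₂) ,
        subst (Adj G _) (trans (cong tail b′) tail-h) (φ-adj (φ (φ e₂))) ,
        (λ eq → φ⁴≢ g (trans (cong tail (from-g 3)) (trans eq (sym tail-g)))) ,
        -- If these opposite corners coincided, the head of `e₁` would have degree 2.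
        (λ eq → rotate²≢ h (trans (cong rotate (sym (trans (opposite eq) (φ-def e₁))))
                              (trans (sym (φ-def _)) b′))))
      where
      b′ : φ (φ (φ e₂)) ≡ h
      b′ = trans (sym (from-h 5)) b
      opposite : tail (φ (φ e₁)) ≡ tail (φ (φ e₂)) → α (φ (φ e₂)) ≡ φ e₁
      opposite eq = dart-≡
        (trans (α-tail _) (trans (sym (φ-tail _)) (trans (cong tail b′) tail-h)))
        (trans (α-head _) (trans (sym eq) (φ-tail _)))

  -- Now the face of `g` follows three sides of the 4-cycle and that of `h` one side. A pentagon at
  -- `g` identifies the heads of `e₁` and `e₂`, so that the face of `h` returns after three steps.
  -- Otherwise `φ e₁` joins these heads, and the face of `h` completes a triangle if it is a
  -- pentagon and a 4-cycle if it is a hexagon.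
  consecutive : ∀ {d₀ d₁ d₂ d₃} →
    TurnL d₀ d₁ → TurnL d₁ d₂ → TurnR d₂ d₃ → TurnR d₃ d₀ →
    Hexagonal d₀ × Hexagonal d₃ × OnSquare (head (φ d₂)) × OnSquare (head (φ d₃))
  consecutive {d₀} {d₁} {d₂} {d₃} refl refl refl p₀ =
    cases (pentagonOrHexagon g) (pentagonOrHexagon h)
    where
    e₁ = φ d₂
    e₂ = φ d₃
    g = α e₂
    h = α e₁
    φg : φ g ≡ d₀
    φg = trans (φ-α e₂) (sym p₀)
    φh : φ h ≡ d₃
    φh = φ-α e₁
    tail-g : tail g ≡ tail (φ e₂)
    tail-g = trans (α-tail e₂) (sym (φ-tail e₂))
    tail-h : tail h ≡ tail (φ e₁)
    tail-h = trans (α-tail e₁) (sym (φ-tail e₁))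
    from-g : ∀ k → iterate φ g (suc k) ≡ iterate φ d₀ k
    from-g k = cong (λ d → iterate φ d k) φg
    from-h : ∀ k → iterate φ h (suc k) ≡ iterate φ d₃ k
    from-h k = cong (λ d → iterate φ d k) φh
    cases : iterate φ g 5 ≡ g ⊎ Hexagonal g → iterate φ h 5 ≡ h ⊎ Hexagonal h →
      Hexagonal d₀ × Hexagonal d₃ × OnSquare (head e₁) × OnSquare (head e₂)
    cases (inj₁ a) _ = contradiction
      (trans (cong tail (from-h 2)) (trans (sym tail-g)
        (trans (cong tail (trans (sym a) (from-g 4))) (sym tail-h))))
      (φ³≢ h)
    cases (inj₂ a) (inj₁ b) = ⊥-elim (triangle-free
      (subst (Adj G _) (trans (cong tail (trans (sym (from-g 5)) a)) tail-g) (φ-adj (φ e₁)))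
      (φ-adj (φ e₂))
      (subst (Adj G _) (trans (cong tail (trans (sym (from-h 4)) b)) tail-h) (φ-adj (φ (φ e₂)))))
    cases (inj₂ a) (inj₂ b) =
      subst Hexagonal φg (Hexagonal-φ {g} a) ,
      subst Hexagonal φh (Hexagonal-φ {h} b) ,
      subst OnSquare (φ-tail e₁) (
        tail (φ e₂) , tail (φ (φ e₂)) , tail (φ (φ (φ e₂))) , pq , qr , rs , sp , p≢r , q≢s) ,
      subst OnSquare (φ-tail e₂) (
        tail (φ (φ e₂)) , tail (φ (φ (φ e₂))) , tail (φ e₁) , qr , rs , sp , pq , q≢s , p≢r ∘ sym)
      where
      pq = subst (Adj G _) (trans (cong tail (trans (sym (from-g 5)) a)) tail-g) (φ-adj (φ e₁))
      qr = φ-adj (φ e₂)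
      rs = φ-adj (φ (φ e₂))
      sp = subst (Adj G _) (trans (cong tail (trans (sym (from-h 5)) b)) tail-h) (φ-adj (φ (φ (φ e₂))))
      p≢r : tail (φ e₁) ≢ tail (φ (φ e₂))
      p≢r eq = φ⁴≢ h (trans (cong tail (from-h 3)) (trans (sym eq) (sym tail-h)))
      q≢s : tail (φ e₂) ≢ tail (φ (φ (φ e₂)))
      q≢s eq = φ²≢ (φ e₂) (sym eq)

  Turn : Dart G → Dart G → Set
  Turn d e = TurnL d e ⊎ TurnR d e

  reverse-turn : ∀ {d e} → Turn d e → Turn (α e) (α d)
  reverse-turn (inj₁ p) = inj₂ (reverseL p)
  reverse-turn (inj₂ p) = inj₁ (reverseR p)

  -- Three equal turns in a row would let a face revisit a vertex after four steps. What remains are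
  -- the cyclic shifts of the patterns in `alternating` and `consecutive`.
  left-side : ∀ {d₀ d₁ d₂ d₃} →
    head d₀ ≡ tail d₁ → head d₁ ≡ tail d₂ → head d₂ ≡ tail d₃ → head d₃ ≡ tail d₀ →
    Turn d₀ d₁ → Turn d₁ d₂ → Turn d₂ d₃ → Turn d₃ d₀ →
    Hexagonal d₃ × Hexagonal d₀ × (TurnR d₃ d₀ → OnSquare (head (φ d₃)))
  left-side {d₀} {d₁} {d₂} {d₃} h₀ h₁ h₂ h₃ = cases
    where
    LLL : ∀ {d e f g} → TurnL d e → TurnL e f → TurnL f g → head g ≢ tail d
    LLL {d} refl refl refl h = φ⁴≢ d (trans (φ-tail _) h)
    RRR : ∀ {d e f g} → TurnR d e → TurnR e f → TurnR f g → head g ≢ tail d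
    RRR {d} {g = g} p q r h =
      LLL (reverseR r) (reverseR q) (reverseR p) (trans (α-head d) (trans (sym h) (sym (α-tail g))))
    notR : ∀ {d e} {A : Set} → TurnL d e → TurnR d e → A
    notR refl q = contradiction (sym q) (rotate≢ _)
    cases : Turn d₀ d₁ → Turn d₁ d₂ → Turn d₂ d₃ → Turn d₃ d₀ →
      Hexagonal d₃ × Hexagonal d₀ × (TurnR d₃ d₀ → OnSquare (head (φ d₃)))
    cases (inj₁ p) (inj₁ q) (inj₁ r) _        = ⊥-elim (LLL p q r h₃)
    cases (inj₁ p) (inj₁ q) (inj₂ r) (inj₁ s) = ⊥-elim (LLL s p q h₂)
    cases (inj₁ p) (inj₂ q) (inj₁ r) (inj₁ s) = ⊥-elim (LLL r s p h₁)
    cases (inj₂ p) (inj₁ q) (inj₁ r) (inj₁ s) = ⊥-elim (LLL q r s h₀)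
    cases (inj₂ p) (inj₂ q) (inj₂ r) _        = ⊥-elim (RRR p q r h₃)
    cases (inj₂ p) (inj₂ q) (inj₁ r) (inj₂ s) = ⊥-elim (RRR s p q h₂)
    cases (inj₂ p) (inj₁ q) (inj₂ r) (inj₂ s) = ⊥-elim (RRR r s p h₁)
    cases (inj₁ p) (inj₂ q) (inj₂ r) (inj₂ s) = ⊥-elim (RRR q r s h₀)
    cases (inj₁ p) (inj₂ q) (inj₁ r) (inj₂ s) =
      let hex₀ , _ = alternating p q r s
          hex₂ , sq = alternating r s p q
      in subst Hexagonal (sym r) (Hexagonal-φ {d₂} hex₂) , hex₀ , λ _ → sq
    cases (inj₂ p) (inj₁ q) (inj₂ r) (inj₁ s) =
      let hex₃ , _ = alternating s p q r
      in hex₃ , subst Hexagonal (sym s) (Hexagonal-φ {d₃} hex₃) , notR s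
    cases (inj₁ p) (inj₁ q) (inj₂ r) (inj₂ s) =
      let hex₀ , hex₃ , _ , sq = consecutive p q r s in hex₃ , hex₀ , λ _ → sq
    cases (inj₁ p) (inj₂ q) (inj₂ r) (inj₁ s) =
      let hex₃ , _ = consecutive s p q r
      in hex₃ , subst Hexagonal (sym s) (Hexagonal-φ {d₃} hex₃) , notR s
    cases (inj₂ p) (inj₂ q) (inj₁ r) (inj₁ s) =
      let hex₂ , _ = consecutive r s p q
          hex₃ = subst Hexagonal (sym r) (Hexagonal-φ {d₂} hex₂)
      in hex₃ , subst Hexagonal (sym s) (Hexagonal-φ {d₃} hex₃) , notR s
    cases (inj₂ p) (inj₁ q) (inj₁ r) (inj₂ s) =
      let hex₁ , hex₀ , sq , _ = consecutive q r s p
          hex₂ = subst Hexagonal (sym q) (Hexagonal-φ {d₁} hex₁)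
      in subst Hexagonal (sym r) (Hexagonal-φ {d₂} hex₂) , hex₀ , λ _ → sq

  -- Two of the darts at `v` run along the 4-cycle. The third leaves it on the left or on the right,
  -- according to the turn at `v`, and is covered by `left-side` for the cycle or for its reversal.
  square-spreads : ∀ {v} → OnSquare v →
    (∀ d → tail d ≡ v → Hexagonal d × OnSquare (head d))
  square-spreads {v} (a , b , c , va , ab , bc , cv , v≢b , a≢c) =
    corner (turn d₃ d₀ refl a≢c)
    where
    d₀ = dart v a va
    d₁ = dart a b ab
    d₂ = dart b c bc
    d₃ = dart c v cv
    t₁ = turn d₀ d₁ refl (v≢b ∘ sym)
    t₂ = turn d₁ d₂ refl (a≢c ∘ sym)
    t₃ = turn d₂ d₃ refl v≢b
    t₀ = turn d₃ d₀ refl a≢c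
    left = left-side refl refl refl refl t₁ t₂ t₃ t₀
    joins : ∀ d e → head d ≡ tail e → head (α e) ≡ tail (α d)
    joins d e h = trans (α-head e) (trans (sym h) (sym (α-tail d)))
    -- The reversed cycle is read from `α d₃`, so it also starts at `v`.
    right = left-side (joins d₂ d₃ refl) (joins d₁ d₂ refl) (joins d₀ d₁ refl) (joins d₃ d₀ refl)
      (reverse-turn t₃) (reverse-turn t₂) (reverse-turn t₁) (reverse-turn t₀)
    Spread = λ d → Hexagonal d × OnSquare (head d)
    sq-a : OnSquare a
    sq-a = b , c , v , ab , bc , cv , va , a≢c , v≢b ∘ sym
    sq-c : OnSquare c
    sq-c = v , a , b , cv , va , ab , bc , a≢c ∘ sym , v≢b
    s₀ : Spread d₀
    s₀ = proj₁ (proj₂ left) , sq-a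
    s₃ : Spread (α d₃)
    s₃ = proj₁ (proj₂ right) , subst OnSquare (sym (α-head d₃)) sq-c
    corner : Turn d₃ d₀ → ∀ d → tail d ≡ v → Spread d
    corner (inj₁ p) = λ d t → rotate-elim Spread (α d₃) s₃ (subst Spread (trans p (φ-def d₃)) s₀)
      (subst Spread (trans (φ-α d₀) (cong rotate (trans p (φ-def d₃))))
        (Hexagonal-φ {α d₀} (proj₁ right) , proj₂ (proj₂ right) (reverseL p))) d (trans t (sym (α-tail d₃)))
    corner (inj₂ p) = λ d t → rotate-elim Spread (α d₃) s₃
      (subst Spread (φ-def d₃) (Hexagonal-φ {d₃} (proj₁ left) , proj₂ (proj₂ left) p))
      (subst Spread (trans p (cong rotate (φ-def d₃))) s₀) d (trans t (sym (α-tail d₃)))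

  φ≢ : ∀ d → tail (φ d) ≢ tail d
  φ≢ d eq = Adj⇒≢ (adjacent d) (trans (sym eq) (φ-tail d))

  φ⁵≢ : ∀ d → Hexagonal d → tail (iterate φ d 5) ≢ tail d
  φ⁵≢ d hex eq = φ≢ (iterate φ d 5) (trans (cong tail hex) (sym eq))

  φ-distinct-darts : ∀ k d → FaceBoundedByCycle k d → Injective _≡_ _≡_ (λ (i : Fin k) → iterate φ d (toℕ i))
  φ-distinct-darts k d b {i} {j} eq = φ-distinct k d b (begin
    tail (iterate φ d (toℕ (inject₁ i))) ≡⟨ cong (tail ∘ iterate φ d) (toℕ-inject₁ i) ⟩
    tail (iterate φ d (toℕ i))           ≡⟨ cong tail eq ⟩
    tail (iterate φ d (toℕ j))           ≡⟨ cong (tail ∘ iterate φ d) (toℕ-inject₁ j) ⟨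
    tail (iterate φ d (toℕ (inject₁ j))) ∎)
    where open ≡-Reasoning

  -- Euler's formula doubled, with the edges eliminated by the handshake inequality.
  n+4≤numFaces*2 : n + 4 ≤ numFaces * 2
  n+4≤numFaces*2 = ℕₚ.+-cancelˡ-≤ (n * 2) _ _ (begin
    n * 2 + (n + 4)           ≡⟨ lhs n ⟩
    n * 3 + 4                 ≤⟨ ℕₚ.+-monoˡ-≤ 4 n*3≤edges*2 ⟩
    length (edges G) * 2 + 4  ≡⟨ ℕₚ.*-distribʳ-+ 2 (length (edges G)) 2 ⟨
    (length (edges G) + 2) * 2 ≡⟨ cong (_* 2) euler ⟨
    (n + numFaces) * 2        ≡⟨ ℕₚ.*-distribʳ-+ 2 n numFaces ⟩
    n * 2 + numFaces * 2      ∎)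
    where
    open ℕₚ.≤-Reasoning
    lhs : ∀ n → n * 2 + (n + 4) ≡ n * 3 + 4
    lhs = solve-∀

  -- On the torus all faces could be hexagons; Euler's formula for the sphere forbids it.
  ¬all-hexagonal : ¬ (∀ d → Hexagonal d)
  ¬all-hexagonal hex = ℕₚ.<⇒≱ (ℕₚ.m<m+n (n * 3) {12} (s≤s z≤n)) (begin
    n * 3 + 12       ≡⟨ ℕₚ.*-distribʳ-+ 3 n 4 ⟨
    (n + 4) * 3      ≤⟨ ℕₚ.*-monoˡ-≤ 3 n+4≤numFaces*2 ⟩
    numFaces * 2 * 3 ≡⟨ ℕₚ.*-assoc numFaces 2 3 ⟩
    numFaces * 6     ≤⟨ numFaces*k≤n*3 6 distinct ⟩
    n * 3            ∎)
    where
    open ℕₚ.≤-Reasoning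
    distinct : ∀ d → Injective _≡_ _≡_ (λ (i : Fin 6) → iterate φ d (toℕ i))
    distinct d = [ (λ b → contradiction (cong tail (φ-closes 5 d b)) (φ⁵≢ d (hex d))) ,
                   (λ b → φ-distinct-darts 6 d b) ]′ (bounded d)

  -- Every face has at least five darts, so `5(n + 4) <= 10 numFaces <= 6n`.
  20≤n : 20 ≤ n
  20≤n = ℕₚ.+-cancelˡ-≤ (n * 5) _ _ (begin
    n * 5 + 20       ≡⟨ ℕₚ.*-distribʳ-+ 5 n 4 ⟨
    (n + 4) * 5      ≤⟨ ℕₚ.*-monoˡ-≤ 5 n+4≤numFaces*2 ⟩
    numFaces * 2 * 5 ≡⟨ swap-factors numFaces ⟩
    numFaces * 5 * 2 ≤⟨ ℕₚ.*-monoˡ-≤ 2 (numFaces*k≤n*3 5 distinct) ⟩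
    n * 3 * 2        ≡⟨ rhs n ⟩
    n * 5 + n        ∎)
    where
    open ℕₚ.≤-Reasoning
    swap-factors : ∀ f → f * 2 * 5 ≡ f * 5 * 2
    swap-factors = solve-∀
    rhs : ∀ n → n * 3 * 2 ≡ n * 5 + n
    rhs = solve-∀
    distinct : ∀ d → Injective _≡_ _≡_ (λ (i : Fin 5) → iterate φ d (toℕ i))
    distinct d = [ φ-distinct-darts 5 d ,
      (λ b {i} {j} eq → inject₁-injective (φ-distinct-darts 6 d b {inject₁ i} {inject₁ j}
        (trans (cong (iterate φ d) (toℕ-inject₁ i)) (trans eq (cong (iterate φ d) (sym (toℕ-inject₁ j))))))) ]′
      (bounded d)

  square-free : SquareFree
  square-free v sq = ¬all-hexagonal (λ d → proj₁ (square-spreads (everywhere (connected v (tail d)) sq) d refl))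
    where
    everywhere : ∀ {u w} → Star (Adj G) u w → OnSquare u → OnSquare w
    everywhere ε           s = s
    everywhere (uw ◅ path) s = everywhere path (proj₂ (square-spreads s (dart _ _ uw) refl))

-- Finite search, sums and vertex deletion

search : ∀ {n} {P Q : Fin n → Set} → (∀ i → P i ⊎ Q i) → ∃ P ⊎ (∀ i → Q i)
search {zero}  f = inj₂ λ ()
search {suc n} f with f zero | search (f ∘ suc)
... | inj₁ p | _            = inj₁ (zero , p)
... | inj₂ q | inj₁ (i , p) = inj₁ (suc i , p)
... | inj₂ q | inj₂ r       = inj₂ λ { zero → q ; (suc i) → r i }

bit : Bool → ℕ
bit true  = 1
bit false = 0

T⇒bit : ∀ {b} → T b → bit b ≡ 1
T⇒bit {true} _ = refl

¬T⇒bit : ∀ {b} → ¬ T b → bit b ≡ 0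
¬T⇒bit {true}  t = contradiction _ t
¬T⇒bit {false} _ = refl

bit≤1 : ∀ b → bit b ≤ 1
bit≤1 true  = s≤s z≤n
bit≤1 false = z≤n

sum-change : ∀ {n} {f g : Fin n → ℕ} {c} v →
  (∀ u → u ≢ v → f u ≡ g u) → f v ≡ g v + c → sum f ≡ sum g + c
sum-change {suc n} {f} {g} {c} zero    f≗g fv = begin
  f zero + sum (f ∘ suc)       ≡⟨ cong₂ _+_ fv (sum-cong-≗ (λ u → f≗g (suc u) λ ())) ⟩
  g zero + c + sum (g ∘ suc)   ≡⟨ ℕₚ.+-assoc (g zero) c _ ⟩
  g zero + (c + sum (g ∘ suc)) ≡⟨ cong (g zero +_) (ℕₚ.+-comm c _) ⟩
  g zero + (sum (g ∘ suc) + c) ≡⟨ ℕₚ.+-assoc (g zero) _ c ⟨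
  g zero + sum (g ∘ suc) + c   ∎
  where open ≡-Reasoning
sum-change {suc n} {f} {g} {c} (suc v) f≗g fv = trans
  (cong₂ _+_ (f≗g zero λ ()) (sum-change v (λ u u≢v → f≗g (suc u) (u≢v ∘ suc-injective)) fv))
  (sym (ℕₚ.+-assoc (g zero) _ c))

sum-zero : ∀ {n} {f : Fin n → ℕ} → (∀ v → f v ≡ 0) → sum f ≡ 0
sum-zero {n} f≡0 = trans (sum-cong-≗ f≡0) (sum-replicate-zero n)

sum-const : ∀ n c → sum {n} (λ _ → c) ≡ n * c
sum-const zero    c = refl
sum-const (suc n) c = cong (c +_) (sum-const n c)

sum-bit : ∀ {n} (f : Fin n → Bool) → sum (bit ∘ f) ≡ ∣ Vec.tabulate f ∣
sum-bit {zero}  f = refl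
sum-bit {suc n} f with f zero
... | true  = cong suc (sum-bit (f ∘ suc))
... | false = sum-bit (f ∘ suc)

infixl 6 _∖_

_∖_ : ∀ {n} → (Fin n → Bool) → Fin n → (Fin n → Bool)
(U ∖ v) u with u Fin.≟ v
... | yes _ = false
... | no _  = U u

∖-≢ : ∀ {n} (U : Fin n → Bool) {u v} → u ≢ v → (U ∖ v) u ≡ U u
∖-≢ U {u} {v} u≢v with u Fin.≟ v
... | yes u≡v = contradiction u≡v u≢v
... | no _    = refl

∖-self : ∀ {n} (U : Fin n → Bool) v → (U ∖ v) v ≡ false
∖-self U v with v Fin.≟ v
... | yes _  = refl
... | no v≢v = contradiction refl v≢v

∖⁺ : ∀ {n} (U : Fin n → Bool) {u v} → u ≢ v → T (U u) → T ((U ∖ v) u)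
∖⁺ U u≢v = subst T (sym (∖-≢ U u≢v))

∖⁻ : ∀ {n} (U : Fin n → Bool) {u v} → T ((U ∖ v) u) → u ≢ v × T (U u)
∖⁻ U {u} {v} t with u Fin.≟ v
... | no u≢v = u≢v , t

size : ∀ {n} → (Fin n → Bool) → ℕ
size U = sum (bit ∘ U)

size-∖ : ∀ {n} (U : Fin n → Bool) {v} → T (U v) → size U ≡ suc (size (U ∖ v))
size-∖ U {v} t = trans
  (sum-change v (λ u u≢v → cong bit (sym (∖-≢ U u≢v)))
    (trans (T⇒bit t) (cong (λ b → bit b + 1) (sym (∖-self U v)))))
  (ℕₚ.+-comm _ 1)

-- Degrees in induced subgraphs

module Degrees {n} (G : Graph n) where
  open Graph G
  open Graphs G

  -- Meaningful also for `v` outside `U`, which matters once `v` itself has been deleted.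
  deg : (Fin n → Bool) → Fin n → ℕ
  deg U v = sum λ w → bit (U w) * bit (adj v w)

  degreeSum : (Fin n → Bool) → ℕ
  degreeSum U = sum λ v → bit (U v) * deg U v

  deg-∖ : ∀ U v {w} → T (U w) → deg U v ≡ deg (U ∖ w) v + bit (adj v w)
  deg-∖ U v {w} t = sum-change w
    (λ u u≢w → cong (λ b → bit b * bit (adj v u)) (sym (∖-≢ U u≢w)))
    (trans (cong (_* bit (adj v w)) (T⇒bit t))
      (trans (ℕₚ.+-identityʳ _) (cong (λ b → bit b * bit (adj v w) + bit (adj v w)) (sym (∖-self U w)))))

  deg-∖-≤ : ∀ U v {w k} → T (U w) → suc k ≤ deg U v → k ≤ deg (U ∖ w) v
  deg-∖-≤ U v {w} {k} t k<deg = ℕₚ.+-cancelʳ-≤ 1 k _ (begin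
    k + 1                         ≡⟨ ℕₚ.+-comm k 1 ⟩
    suc k                         ≤⟨ k<deg ⟩
    deg U v                       ≡⟨ deg-∖ U v t ⟩
    deg (U ∖ w) v + bit (adj v w) ≤⟨ ℕₚ.+-monoʳ-≤ _ (bit≤1 (adj v w)) ⟩
    deg (U ∖ w) v + 1             ∎)
    where open ℕₚ.≤-Reasoning

  -- The degree of `v` is lost twice: once as its own term and once spread over its neighbours, by
  -- symmetry of adjacency.
  degreeSum-∖ : ∀ U {v} → T (U v) → degreeSum U ≡ degreeSum (U ∖ v) + (deg U v + deg U v)
  degreeSum-∖ U {v} t = begin
    degreeSum U
      ≡⟨ sum-change {g = g} v off at ⟩
    sum g + deg U v
      ≡⟨ cong (_+ deg U v) (∑-distrib-+ {n} _ _) ⟩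
    degreeSum U′ + sum (λ u → bit (U′ u) * bit (adj u v)) + deg U v
      ≡⟨ cong (λ x → degreeSum U′ + x + deg U v) loss ⟩
    degreeSum U′ + deg U v + deg U v
      ≡⟨ ℕₚ.+-assoc (degreeSum U′) _ _ ⟩
    degreeSum U′ + (deg U v + deg U v) ∎
    where
    open ≡-Reasoning
    U′ = U ∖ v
    g : Fin n → ℕ
    g u = bit (U′ u) * deg U′ u + bit (U′ u) * bit (adj u v)
    off : ∀ u → u ≢ v → bit (U u) * deg U u ≡ g u
    off u u≢v = trans (cong₂ _*_ (cong bit (sym (∖-≢ U u≢v))) (deg-∖ U u t))
      (ℕₚ.*-distribˡ-+ (bit (U′ u)) _ _)
    at : bit (U v) * deg U v ≡ g v + deg U v
    at rewrite ∖-self U v | T⇒bit t = ℕₚ.+-identityʳ _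
    loss : sum (λ u → bit (U′ u) * bit (adj u v)) ≡ deg U v
    loss = trans (sum-cong-≗ (λ u → cong (λ b → bit (U′ u) * bit b) (adj-sym u v)))
      (sym (trans (deg-∖ U v t) (trans (cong (λ b → deg U′ v + bit b) (adj-irrefl v)) (ℕₚ.+-identityʳ _))))

  Nbr : (Fin n → Bool) → Fin n → Fin n → Set
  Nbr U v w = Adj G v w × T (U w)

  TwoNbrs : (Fin n → Bool) → Fin n → Set
  TwoNbrs U v = ∃ λ a → ∃ λ b → a ≢ b × Nbr U v a × Nbr U v b

  0<deg : ∀ U {v w} → Nbr U v w → 0 < deg U v
  0<deg U {v} {w} (a , t) = begin
    1                             ≡⟨ T⇒bit a ⟨
    bit (adj v w)                 ≤⟨ ℕₚ.m≤n+m _ _ ⟩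
    deg (U ∖ w) v + bit (adj v w) ≡⟨ deg-∖ U v t ⟨
    deg U v                       ∎
    where open ℕₚ.≤-Reasoning

  suc-deg-∖ : ∀ U {v w k} → Nbr U v w → k ≤ deg (U ∖ w) v → suc k ≤ deg U v
  suc-deg-∖ U {v} {w} {k} (a , t) k≤ = begin
    suc k                         ≡⟨ ℕₚ.+-comm 1 k ⟩
    k + 1                         ≤⟨ ℕₚ.+-mono-≤ k≤ (ℕₚ.≤-reflexive (sym (T⇒bit a))) ⟩
    deg (U ∖ w) v + bit (adj v w) ≡⟨ deg-∖ U v t ⟨
    deg U v                       ∎
    where open ℕₚ.≤-Reasoning

  1<deg : ∀ U {v} → TwoNbrs U v → 1 < deg U v
  1<deg U (a , b , a≢b , na , nb , t) = suc-deg-∖ U na (0<deg (U ∖ a) (nb , ∖⁺ U (a≢b ∘ sym) t))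

-- Arithmetic of the bound

-- up s e / down s e bounds the number of perfect matchings for s vertices and degree sum e.  Two
-- vertices of degree 3 contribute (8/9)²(71/63)⁶ ≈ 1.6188, which is just above the golden ratio
-- (1/x + 1/x² ≤ 1 is needed when a forced edge follows one of two branches) and below 20^(1/6).
-- Opaque because multiplication by a literal unfolds into repeated addition.
opaque
  up down : ℕ → ℕ → ℕ
  up   s e = 8 ^ s * 71 ^ e
  down s e = 9 ^ s * 63 ^ e

  up-nonZero : ∀ s e → NonZero (up s e)
  up-nonZero s e = ℕₚ.m*n≢0 (8 ^ s) (71 ^ e) {{ℕₚ.m^n≢0 8 s}} {{ℕₚ.m^n≢0 71 e}}

  down≤up : ∀ e → down 0 e ≤ up 0 e
  down≤up e = ℕₚ.*-monoʳ-≤ 1 (ℕₚ.^-monoˡ-≤ e (ℕₚ.m≤m+n 63 8))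

  leaf-numeric : down 2 2 ≤ up 2 2
  leaf-numeric = ℕₚ.≤ᵇ⇒≤ _ _ _

  33-numeric : up 2 8 * down 2 8 + up 2 8 * down 2 8 ≤ up 2 8 * up 2 8
  33-numeric = ℕₚ.≤ᵇ⇒≤ _ _ _

  23-numeric : up 4 12 * down 2 6 + up 2 6 * down 4 12 ≤ up 2 6 * up 4 12
  23-numeric = ℕₚ.≤ᵇ⇒≤ _ _ _

  32-numeric : up 2 6 * down 4 12 + up 4 12 * down 2 6 ≤ up 4 12 * up 2 6
  32-numeric = ℕₚ.≤ᵇ⇒≤ _ _ _

  22-numeric : up 4 10 * down 4 10 + up 4 10 * down 4 10 ≤ up 4 10 * up 4 10
  22-numeric = ℕₚ.≤ᵇ⇒≤ _ _ _

^*^-+ : ∀ a b i j s e → a ^ (i + s) * b ^ (j + e) ≡ a ^ i * b ^ j * (a ^ s * b ^ e)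
^*^-+ a b i j s e = trans
  (cong₂ _*_ (ℕₚ.^-distribˡ-+-* a i s) (ℕₚ.^-distribˡ-+-* b j e))
  (ℕₚ.[m*n]*[o*p]≡[m*o]*[n*p] (a ^ i) (a ^ s) (b ^ j) (b ^ e))

opaque
  unfolding up

  up-+ : ∀ i j s e → up (i + s) (j + e) ≡ up i j * up s e
  up-+ = ^*^-+ 8 71

  down-+ : ∀ i j s e → down (i + s) (j + e) ≡ down i j * down s e
  down-+ = ^*^-+ 9 63

Bounded : ℕ → ℕ → ℕ → Set
Bounded s e ℓ = ℓ * down s e ≤ up s e

-- Without denominators, `ℓ <= (up s e / down s e) * (d / c)`. For `c = up i j` and `d = down i j`
-- this is the bound left after removing `i` vertices and `j` from the degree sum.
ScaledBound : ℕ → ℕ → ℕ → ℕ → ℕ → Set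
ScaledBound s e c d ℓ = ℓ * down s e * c ≤ up s e * d

-- Since `71/63 >= 1`, overstating the degree sum is harmless, so a branch only has to bound its
-- loss of degrees from below.
Bounded-mono : ∀ {s e ℓ} k → Bounded s e ℓ → Bounded s (k + e) ℓ
Bounded-mono {s} {e} {ℓ} k b = begin
  ℓ * down s (k + e)       ≡⟨ cong (ℓ *_) (down-+ 0 k s e) ⟩
  ℓ * (down 0 k * down s e) ≡⟨ lhs ℓ (down 0 k) (down s e) ⟩
  down 0 k * (ℓ * down s e) ≤⟨ ℕₚ.*-mono-≤ (down≤up k) b ⟩
  up 0 k * up s e          ≡⟨ up-+ 0 k s e ⟨
  up s (k + e)             ∎
  where
  open ℕₚ.≤-Reasoning
  lhs : ∀ ℓ a b → ℓ * (a * b) ≡ a * (ℓ * b)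
  lhs = solve-∀

Bounded⇒Scaled : ∀ {s e ℓ s′ e′} i j → s ≡ i + s′ → j + e′ ≤ e →
  Bounded s′ e′ ℓ → ScaledBound s e (up i j) (down i j) ℓ
Bounded⇒Scaled {e = e} {ℓ} {s′} {e′} i j refl j+e′≤e b
  with k , refl ← ℕₚ.m≤n⇒∃[o]m+o≡n j+e′≤e = begin
  ℓ * down (i + s′) (j + e′ + k) * up i j
    ≡⟨ cong (λ x → ℓ * x * up i j) (trans (cong (down (i + s′)) shift) (down-+ i j s′ (k + e′))) ⟩
  ℓ * (down i j * down s′ (k + e′)) * up i j
    ≡⟨ lhs ℓ (down i j) (down s′ (k + e′)) (up i j) ⟩
  ℓ * down s′ (k + e′) * (down i j * up i j)
    ≤⟨ ℕₚ.*-monoˡ-≤ _ (Bounded-mono {s′} {e′} {ℓ} k b) ⟩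
  up s′ (k + e′) * (down i j * up i j)
    ≡⟨ rhs (up s′ (k + e′)) (down i j) (up i j) ⟩
  up i j * up s′ (k + e′) * down i j
    ≡⟨ cong (_* down i j) (trans (cong (up (i + s′)) shift) (up-+ i j s′ (k + e′))) ⟨
  up (i + s′) (j + e′ + k) * down i j ∎
  where
  open ℕₚ.≤-Reasoning
  shift : j + e′ + k ≡ j + (k + e′)
  shift = trans (ℕₚ.+-assoc j e′ k) (cong (j +_) (ℕₚ.+-comm e′ k))
  lhs : ∀ ℓ a b c → ℓ * (a * b) * c ≡ ℓ * b * (a * c)
  lhs = solve-∀
  rhs : ∀ x a c → x * (a * c) ≡ c * x * a
  rhs = solve-∀

Scaled⇒Bounded : ∀ {s e c d ℓ} .{{_ : NonZero c}} → d ≤ c → ScaledBound s e c d ℓ → Bounded s e ℓ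
Scaled⇒Bounded {s} {e} {c} d≤c b =
  ℕₚ.*-cancelʳ-≤ _ _ c (ℕₚ.≤-trans b (ℕₚ.*-monoʳ-≤ (up s e) d≤c))

Scaled-+ : ∀ {s e c d₁ d₂ ℓ₁ ℓ₂} → ScaledBound s e c d₁ ℓ₁ → ScaledBound s e c d₂ ℓ₂ →
  ScaledBound s e c (d₁ + d₂) (ℓ₁ + ℓ₂)
Scaled-+ {s} {e} {c} {d₁} {d₂} {ℓ₁} {ℓ₂} b₁ b₂ = begin
  (ℓ₁ + ℓ₂) * down s e * c              ≡⟨ lhs ℓ₁ ℓ₂ (down s e) c ⟩
  ℓ₁ * down s e * c + ℓ₂ * down s e * c ≤⟨ ℕₚ.+-mono-≤ b₁ b₂ ⟩
  up s e * d₁ + up s e * d₂             ≡⟨ ℕₚ.*-distribˡ-+ (up s e) d₁ d₂ ⟨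
  up s e * (d₁ + d₂)                    ∎
  where
  open ℕₚ.≤-Reasoning
  lhs : ∀ a b y c → (a + b) * y * c ≡ a * y * c + b * y * c
  lhs = solve-∀

Scaled-rescale : ∀ {s e c d ℓ} k → ScaledBound s e c d ℓ → ScaledBound s e (k * c) (k * d) ℓ
Scaled-rescale {s} {e} {c} {d} {ℓ} k b = begin
  ℓ * down s e * (k * c) ≡⟨ comm (ℓ * down s e) k c ⟩
  k * (ℓ * down s e * c) ≤⟨ ℕₚ.*-monoʳ-≤ k b ⟩
  k * (up s e * d)       ≡⟨ comm (up s e) k d ⟨
  up s e * (k * d)       ∎
  where
  open ℕₚ.≤-Reasoning
  comm : ∀ x k y → x * (k * y) ≡ k * (x * y)
  comm = solve-∀

Scaled-≤ : ∀ {s e c d k ℓ} → k ≤ ℓ → ScaledBound s e c d ℓ → ScaledBound s e c d k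
Scaled-≤ {s} {e} {c} k≤ℓ = ℕₚ.≤-trans (ℕₚ.*-monoˡ-≤ c (ℕₚ.*-monoˡ-≤ (down s e) k≤ℓ))

length≤filter+filter : ∀ {A : Set} {P : Pred A 0ℓ} (P? : Decidable P) (xs : List A) →
  length xs ≤ length (filter P? xs) + length (filter (¬? ∘ P?) xs)
length≤filter+filter P? []       = z≤n
length≤filter+filter P? (x ∷ xs) with P? x
... | yes _ = s≤s (length≤filter+filter P? xs)
... | no _  = ℕₚ.≤-trans (s≤s (length≤filter+filter P? xs)) (ℕₚ.≤-reflexive (sym (ℕₚ.+-suc _ _)))

-- Local structure of induced subgraphs of a cubic graph

module Neighbourhoods {n} (G : Graph n) (cubic : Cubic G) where
  open CubicGraphs G cubic public
  open Degrees G public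

  NoNbr : (Fin n → Bool) → Fin n → Set
  NoNbr U v = ∀ w → ¬ Nbr U v w

  OneNbr : (Fin n → Bool) → Fin n → Set
  OneNbr U v = ∃ λ a → Nbr U v a × (∀ w → Nbr U v w → w ≡ a)

  OnlyNbrs : (Fin n → Bool) → Fin n → Fin n → Fin n → Set
  OnlyNbrs U v a b = a ≢ b × Nbr U v a × Nbr U v b × (∀ w → Nbr U v w → w ≡ a ⊎ w ≡ b)

  AllNbrs : (Fin n → Bool) → Fin n → Set
  AllNbrs U v = ∀ w → Adj G v w → T (U w)

  nb-elim : ∀ {U v} {P : Fin n → Set} →
    (T (U (nb v 0F)) → P (nb v 0F)) → (T (U (nb v 1F)) → P (nb v 1F)) → (T (U (nb v 2F)) → P (nb v 2F)) →
    ∀ w → Nbr U v w → P w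
  nb-elim p₀ p₁ p₂ w (a , t) with nb-surjective a
  ... | 0F , refl = p₀ t
  ... | 1F , refl = p₁ t
  ... | 2F , refl = p₂ t

  nb-≢ : ∀ v {i j} → i ≢ j → nb v i ≢ nb v j
  nb-≢ v i≢j eq = i≢j (nb-injective v eq)

  -- The sum is nested so that its outer split separates degree at most 1, where nothing branches,
  -- from degrees 2 and 3.
  neighbourhood : ∀ U v →
    (NoNbr U v ⊎ OneNbr U v) ⊎ ((∃ λ a → ∃ λ b → OnlyNbrs U v a b) ⊎ AllNbrs U v)
  neighbourhood U v with T? (U (nb v 0F)) | T? (U (nb v 1F)) | T? (U (nb v 2F))
  ... | no x  | no y  | no z  = inj₁ (inj₁ (nb-elim x y z))
  ... | yes x | no y  | no z  = inj₁ (inj₂ (_ , (nb-adj v 0F , x) ,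
        nb-elim (λ _ → refl) (⊥-elim ∘ y) (⊥-elim ∘ z)))
  ... | no x  | yes y | no z  = inj₁ (inj₂ (_ , (nb-adj v 1F , y) ,
        nb-elim (⊥-elim ∘ x) (λ _ → refl) (⊥-elim ∘ z)))
  ... | no x  | no y  | yes z = inj₁ (inj₂ (_ , (nb-adj v 2F , z) ,
        nb-elim (⊥-elim ∘ x) (⊥-elim ∘ y) (λ _ → refl)))
  ... | yes x | yes y | no z  = inj₂ (inj₁ (_ , _ , nb-≢ v (λ ()) , (nb-adj v 0F , x) , (nb-adj v 1F , y) ,
        nb-elim (λ _ → inj₁ refl) (λ _ → inj₂ refl) (⊥-elim ∘ z)))
  ... | yes x | no y  | yes z = inj₂ (inj₁ (_ , _ , nb-≢ v (λ ()) , (nb-adj v 0F , x) , (nb-adj v 2F , z) ,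
        nb-elim (λ _ → inj₁ refl) (⊥-elim ∘ y) (λ _ → inj₂ refl)))
  ... | no x  | yes y | yes z = inj₂ (inj₁ (_ , _ , nb-≢ v (λ ()) , (nb-adj v 1F , y) , (nb-adj v 2F , z) ,
        nb-elim (⊥-elim ∘ x) (λ _ → inj₁ refl) (λ _ → inj₂ refl)))
  ... | yes x | yes y | yes z = inj₂ (inj₂ (λ w a →
        nb-elim {λ _ → true} (λ _ → x) (λ _ → y) (λ _ → z) w (a , _)))

  OnlyNbrs⇒Two : ∀ {U v a b} → OnlyNbrs U v a b → TwoNbrs U v
  OnlyNbrs⇒Two (a≢b , na , nb , _) = _ , _ , a≢b , na , nb

  AllNbrs⇒Nbr : ∀ {U v} → AllNbrs U v → ∀ i → Nbr U v (nb v i)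
  AllNbrs⇒Nbr {v = v} all i = nb-adj v i , all _ (nb-adj v i)

  AllNbrs⇒Two : ∀ {U v} → AllNbrs U v → TwoNbrs U v
  AllNbrs⇒Two {v = v} all = _ , _ , nb-≢ v (λ ()) , AllNbrs⇒Nbr all 0F , AllNbrs⇒Nbr all 1F

  2<deg : ∀ U {v} → AllNbrs U v → 2 < deg U v
  2<deg U {v} all = suc-deg-∖ U (AllNbrs⇒Nbr all 0F)
    (1<deg (U ∖ nb v 0F) (_ , _ , nb-≢ v (λ ()) , left 1F (λ ()) , left 2F (λ ())))
    where
    left : ∀ i → i ≢ 0F → Nbr (U ∖ nb v 0F) v (nb v i)
    left i i≢0 with a , t ← AllNbrs⇒Nbr all i = a , ∖⁺ U (nb-≢ v i≢0) t

  OnlyNbrs-swap : ∀ {U v a b} → OnlyNbrs U v a b → OnlyNbrs U v b a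
  OnlyNbrs-swap (a≢b , na , nb , only) = a≢b ∘ sym , nb , na , λ w → Sum.swap ∘ only w

  otherNbr : ∀ {U b p q v} → OnlyNbrs U b p q → Nbr U b v →
    ∃ λ y → y ≢ v × Nbr U b y × (∀ w → Nbr U b w → w ≢ v → w ≡ y)
  otherNbr {v = v} (p≢q , np , nq , only) nv with only v nv
  ... | inj₁ refl = _ , p≢q ∘ sym , nq , λ w nw w≢v → [ (λ e → contradiction e w≢v) , (λ e → e) ]′ (only w nw)
  ... | inj₂ refl = _ , p≢q , np , λ w nw w≢v → [ (λ e → e) , (λ e → contradiction e w≢v) ]′ (only w nw)

  anotherNbr : ∀ {U v} → TwoNbrs U v → ∀ a → ∃ λ z → z ≢ a × Nbr U v z
  anotherNbr (p , q , p≢q , np , nq) a with p Fin.≟ a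
  ... | yes refl = q , p≢q ∘ sym , nq
  ... | no p≢a   = p , p≢a , np

  Drop : (Fin n → Bool) → (Fin n → Bool) → ℕ → ℕ → Set
  Drop U U′ i j = size U ≡ i + size U′ × j + degreeSum U′ ≤ degreeSum U

  drop-∖ : ∀ U {v} k → T (U v) → k ≤ deg U v → Drop U (U ∖ v) 1 (k + k)
  drop-∖ U {v} k t k≤ = size-∖ U t , (begin
    k + k + degreeSum (U ∖ v)               ≡⟨ ℕₚ.+-comm (k + k) _ ⟩
    degreeSum (U ∖ v) + (k + k)             ≤⟨ ℕₚ.+-monoʳ-≤ (degreeSum (U ∖ v)) (ℕₚ.+-mono-≤ k≤ k≤) ⟩
    degreeSum (U ∖ v) + (deg U v + deg U v) ≡⟨ degreeSum-∖ U t ⟨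
    degreeSum U                             ∎)
    where open ℕₚ.≤-Reasoning

  drop-trans : ∀ {U U′ U″ i j k l} → Drop U U′ i j → Drop U′ U″ k l → Drop U U″ (i + k) (j + l)
  drop-trans {i = i} {j} {k} {l} (s , d) (s′ , d′) =
    trans s (trans (cong (i +_) s′) (sym (ℕₚ.+-assoc i k _))) ,
    ℕₚ.≤-trans (ℕₚ.≤-reflexive (ℕₚ.+-assoc j l _)) (ℕₚ.≤-trans (ℕₚ.+-monoʳ-≤ j d′) d)

-- The branching estimate for families of perfect matchings

module Families {n} (G : Graph n) (cubic : Cubic G)
  (connected : Connected G) (tri : Graphs.TriangleFree G) (sq : Graphs.SquareFree G)
  {X : Set} (Good : X → Set) (partner : X → Fin n → Fin n)
  (partner-adj : ∀ {M} → Good M → ∀ v → Adj G v (partner M v))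
  (partner-involutive : ∀ {M} → Good M → ∀ v → partner M (partner M v) ≡ v)
  (partner-injective : ∀ {M N} → Good M → Good N → (∀ v → partner M v ≡ partner N v) → M ≡ N)
  where
  open Neighbourhoods G cubic

  -- Distinct perfect matchings that respect U and agree off U, hence differ by
  -- distinct perfect matchings of the subgraph induced by U.
  record Family (U : Fin n → Bool) (L : List X) : Set where
    field
      good   : ∀ {M} → M ∈ₗ L → Good M
      unique : Unique L
      closed : ∀ {M} → M ∈ₗ L → ∀ {v} → T (U v) → T (U (partner M v))
      agree  : ∀ {M N} → M ∈ₗ L → N ∈ₗ L → ∀ {v} → ¬ T (U v) → partner M v ≡ partner N v

    partner-Nbr : ∀ {M} → M ∈ₗ L → ∀ {v} → T (U v) → Nbr U v (partner M v)
    partner-Nbr m t = partner-adj (good m) _ , closed m t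

  open Family

  Matches : List X → Fin n → Fin n → Set
  Matches L v a = ∀ {M} → M ∈ₗ L → partner M v ≡ a

  family-filter : ∀ {U L} {P : Pred X 0ℓ} (P? : Decidable P) → Family U L → Family U (filter P? L)
  family-filter {L = L} P? F = record
    { good   = good F ∘ back
    ; unique = Unique-filter⁺ P? (unique F)
    ; closed = closed F ∘ back
    ; agree  = λ m m′ → agree F (back m) (back m′)
    }
    where
    back : ∀ {M} → M ∈ₗ filter P? L → M ∈ₗ L
    back m = proj₁ (∈-filter⁻ P? {xs = L} m)

  -- Partners are involutive, so no other vertex is matched to `v` or `a`; on these two the
  -- matchings agree by `Matches`.
  family-∖∖ : ∀ {U L v a} → Family U L → Matches L v a → Family (U ∖ v ∖ a) L
  family-∖∖ {U} {L} {v} {a} F va = record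
    { good   = good F
    ; unique = unique F
    ; closed = λ m t →
        let x≢a , t′ = ∖⁻ (U ∖ v) t ; x≢v , t″ = ∖⁻ U t′ in
        ∖⁺ (U ∖ v) (λ e → x≢v (back m (trans e (sym (va m)))))
          (∖⁺ U (λ e → x≢a (back m (trans e (sym (av m))))) (closed F m t″))
    ; agree  = agree′
    }
    where
    av : Matches L a v
    av {M} m = trans (cong (partner M) (sym (va m))) (partner-involutive (good F m) v)
    back : ∀ {M} → M ∈ₗ L → ∀ {x y} → partner M x ≡ partner M y → x ≡ y
    back {M} m {x} {y} e = trans (sym (partner-involutive (good F m) x))
      (trans (cong (partner M) e) (partner-involutive (good F m) y))
    agree′ : ∀ {M N} → M ∈ₗ L → N ∈ₗ L → ∀ {x} → ¬ T ((U ∖ v ∖ a) x) → partner M x ≡ partner N x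
    agree′ m m′ {x} out with x Fin.≟ a
    ... | yes refl = trans (av m) (sym (av m′))
    ... | no _ with x Fin.≟ v
    ...   | yes refl = trans (va m) (sym (va m′))
    ...   | no _     = agree F m m′ out

  -- The condition under which connectedness supplies a vertex of degree at most 2 in a nonempty
  -- `U`.
  Proper : (Fin n → Bool) → Set
  Proper U = ∃ λ x → ¬ T (U x)

  proper-∖ : ∀ U v → Proper (U ∖ v)
  proper-∖ U v = v , subst T (∖-self U v)

  Estimate : (Fin n → Bool) → List X → Set
  Estimate U L = Bounded (size U) (degreeSum U) (length L)

  ScaledEstimate : (Fin n → Bool) → ℕ → ℕ → List X → Set
  ScaledEstimate U i j L =
    ScaledBound (size U) (degreeSum U) (up i j) (down i j) (length L)

  EstimateBelow : (Fin n → Bool) → Set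
  EstimateBelow U = ∀ {U′ L} → size U′ < size U → Proper U′ → Family U′ L → Estimate U′ L

  module _ {U : Fin n → Bool} (below : EstimateBelow U) where

    scaled : ∀ {U′ L} i j → Drop U U′ (suc i) j → Proper U′ → Family U′ L → ScaledEstimate U (suc i) j L
    scaled {U′} {L} i j (s , d) proper F =
      Bounded⇒Scaled {ℓ = length L} {s′ = size U′} {e′ = degreeSum U′} (suc i) j s d
        (below {U′} {L} (subst (size U′ <_) (sym s) (s≤s (ℕₚ.m≤n+m _ i))) proper F)

    -- A deleted vertex costs twice its current degree. Deleting `v` takes one neighbour from `a`,
    -- hence `l` where `a` has degree `suc l`.
    one-edge : ∀ {L v a} k l → Family U L → T (U v) → Nbr U v a → Matches L v a →
      k ≤ deg U v → suc l ≤ deg U a → ScaledEstimate U 2 (k + k + (l + l)) L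
    one-edge {L} {v} {a} k l F t (v~a , ta) va k≤ l< = scaled {L = L} 1 (k + k + (l + l))
      (drop-trans (drop-∖ U k t k≤) (drop-∖ (U ∖ v) l (∖⁺ U (Adj⇒≢ v~a ∘ sym) ta) (deg-∖-≤ U a t l<)))
      (proper-∖ (U ∖ v) a) (family-∖∖ F va)

    -- Once v is matched to a, its other neighbour b is left with a single neighbour y.
    two-edges : ∀ {L v a b p q} l → (∀ {w} → T (U w) → TwoNbrs U w) →
      Family U L → T (U v) → OnlyNbrs U v a b → OnlyNbrs U b p q → Matches L v a →
      suc l ≤ deg U a → ScaledEstimate U 4 (4 + (l + l) + 4) L
    two-edges {L} {v} {a} {b} l two F t only@(a≢b , (v~a , ta) , (v~b , tb) , only-ab) only-b va l<
      with y , y≢v , (b~y , ty) , only-y ← otherNbr only-b (Adj-sym v~b , t)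
      with z , z≢b , (y~z , tz) ← anotherNbr (two ty) b =
      scaled {L = L} 3 (4 + (l + l) + 4)
        (drop-trans (drop-trans (drop-∖ U 2 t (1<deg U (OnlyNbrs⇒Two {U} only)))
            (drop-∖ (U ∖ v) l ta′ (deg-∖-≤ U a t l<)))
          -- The last 4 of the drop: `b` still has `y` and `y` still has `z`, so each costs at least
          -- 2. Here `y≢a` excludes a triangle and `z≢a` a 4-cycle.
          (drop-trans (drop-∖ (U ∖ v ∖ a) 1 tb′ (0<deg (U ∖ v ∖ a) (b~y , ty′)))
            (drop-∖ (U ∖ v ∖ a ∖ b) 1 (∖⁺ (U ∖ v ∖ a) y≢b ty′)
              (0<deg (U ∖ v ∖ a ∖ b) (y~z , ∖⁺ (U ∖ v ∖ a) z≢b (∖⁺ (U ∖ v) z≢a (∖⁺ U z≢v tz)))))))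
        (proper-∖ (U ∖ v ∖ a ∖ b) y) (family-∖∖ (family-∖∖ F va) by)
      where
      y≢a : y ≢ a
      y≢a refl = tri v~b b~y (Adj-sym v~a)
      y≢b : y ≢ b
      y≢b = Adj⇒≢ b~y ∘ sym
      z≢v : z ≢ v
      z≢v refl = [ y≢a , y≢b ]′ (only-ab y (Adj-sym y~z , ty))
      z≢a : z ≢ a
      z≢a refl = sq v (a , y , b , v~a , Adj-sym y~z , Adj-sym b~y , Adj-sym v~b , y≢v ∘ sym , a≢b)
      ta′ : T ((U ∖ v) a)
      ta′ = ∖⁺ U (Adj⇒≢ v~a ∘ sym) ta
      tb′ : T ((U ∖ v ∖ a) b)
      tb′ = ∖⁺ (U ∖ v) (a≢b ∘ sym) (∖⁺ U (Adj⇒≢ v~b ∘ sym) tb)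
      ty′ : T ((U ∖ v ∖ a) y)
      ty′ = ∖⁺ (U ∖ v) y≢a (∖⁺ U y≢v ty)
      by : Matches L b y
      by {M} m = only-y (partner M b) (partner-Nbr F m tb) λ e →
        a≢b (trans (sym (va m)) (trans (cong (partner M) (sym e)) (partner-involutive (good F m) b)))

    -- The numerical hypothesis is `1/x₁ + 1/x₂ <= 1` for the shrinking factors `up / down` of the
    -- two branches, multiplied by the common denominator `up i₁ j₁ * up i₂ j₂`.
    branch : ∀ {L v a b} i₁ j₁ i₂ j₂ → Family U L → T (U v) → OnlyNbrs U v a b →
      (∀ {L} → Family U L → Matches L v a → ScaledEstimate U i₁ j₁ L) →
      (∀ {L} → Family U L → Matches L v b → ScaledEstimate U i₂ j₂ L) →
      up i₂ j₂ * down i₁ j₁ + up i₁ j₁ * down i₂ j₂ ≤ up i₁ j₁ * up i₂ j₂ →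
      Estimate U L
    branch {L} {v} {a} {b} i₁ j₁ i₂ j₂ F t (_ , _ , _ , only) est-a est-b numeric =
      Scaled⇒Bounded {size U} {degreeSum U} {ℓ = length L}
        {{ℕₚ.m*n≢0 (up i₁ j₁) (up i₂ j₂) {{up-nonZero i₁ j₁}} {{up-nonZero i₂ j₂}}}} numeric
        (Scaled-≤ {size U} {degreeSum U} (length≤filter+filter a? L)
          (Scaled-+ {size U} {degreeSum U} {ℓ₁ = length La} {ℓ₂ = length Lb}
            (subst (λ c → ScaledBound (size U) (degreeSum U) c (up i₂ j₂ * down i₁ j₁) (length La))
              (ℕₚ.*-comm (up i₂ j₂) (up i₁ j₁))
              (Scaled-rescale {size U} {degreeSum U} {ℓ = length La} (up i₂ j₂)
                (est-a {La} (family-filter a? F) (λ m → proj₂ (∈-filter⁻ a? {xs = L} m)))))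
            (Scaled-rescale {size U} {degreeSum U} {ℓ = length Lb} (up i₁ j₁)
              (est-b {Lb} (family-filter (¬? ∘ a?) F) matches-b))))
      where
      a? : Decidable (λ M → partner M v ≡ a)
      a? M = partner M v Fin.≟ a
      La = filter a? L
      Lb = filter (¬? ∘ a?) L
      matches-b : Matches Lb v b
      matches-b {M} m with m′ , ≢a ← ∈-filter⁻ (¬? ∘ a?) {xs = L} m =
        [ (λ e → contradiction e ≢a) , (λ e → e) ]′ (only _ (partner-Nbr F m′ t))

    -- Every vertex is off `U`, so the members of the family agree everywhere and there is at most
    -- one.
    empty : ∀ {L} → Family U L → (∀ v → ¬ T (U v)) → Estimate U L
    empty {L} F out = begin
      length L * down (size U) (degreeSum U)
        ≡⟨ cong₂ (λ s e → length L * down s e) size≡0 degreeSum≡0 ⟩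
      length L * down 0 0
        ≤⟨ ℕₚ.*-mono-≤ (atMostOne L F) (down≤up 0) ⟩
      1 * up 0 0
        ≡⟨ ℕₚ.*-identityˡ (up 0 0) ⟩
      up 0 0
        ≡⟨ cong₂ up size≡0 degreeSum≡0 ⟨
      up (size U) (degreeSum U) ∎
      where
      open ℕₚ.≤-Reasoning
      size≡0 : size U ≡ 0
      size≡0 = sum-zero (λ v → ¬T⇒bit (out v))
      degreeSum≡0 : degreeSum U ≡ 0
      degreeSum≡0 = sum-zero (λ v → cong (_* deg U v) (¬T⇒bit (out v)))
      atMostOne : ∀ L → Family U L → length L ≤ 1
      atMostOne []          F = z≤n
      atMostOne (_ ∷ [])    F = s≤s z≤n
      atMostOne (M ∷ N ∷ _) F with (M≢N ∷ _) ∷ _ ← unique F =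
        contradiction (partner-injective (good F m₁) (good F m₂) (λ v → agree F m₁ m₂ (out v))) M≢N
        where
        m₁ = here refl
        m₂ = there (here refl)

    -- The second search starts only after degrees 0 and 1 are excluded; this provides the `two`
    -- that `two-edges` relies on.
    step : ∀ {L} → Proper U → Family U L → Estimate U L
    step {L} (x , x∉U) F with search low
      where
      low : ∀ v → (T (U v) × (NoNbr U v ⊎ OneNbr U v)) ⊎
        (T (U v) → (∃ λ a → ∃ λ b → OnlyNbrs U v a b) ⊎ AllNbrs U v)
      low v with T? (U v) | neighbourhood U v
      ... | no v∉U | _      = inj₂ λ t → contradiction t v∉U
      ... | yes t  | inj₁ p = inj₁ (t , p)
      ... | yes t  | inj₂ q = inj₂ λ _ → q
    ... | inj₁ (v , t , inj₁ none) = isolated L F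
      where
      isolated : ∀ L → Family U L → Estimate U L
      isolated []      F = z≤n
      isolated (M ∷ L) F = contradiction (partner-Nbr F (here refl) t) (none _)
    ... | inj₁ (v , t , inj₂ (a , na , only)) =
      Scaled⇒Bounded {size U} {degreeSum U} {ℓ = length L} {{up-nonZero 2 2}} leaf-numeric
        (one-edge {L} 1 0 F t na (λ m → only _ (partner-Nbr F m t)) (0<deg U na)
          (0<deg U (Adj-sym (proj₁ na) , t)))
    ... | inj₂ high with search high′
      where
      high′ : ∀ v → (T (U v) × (∃ λ a → ∃ λ b → OnlyNbrs U v a b)) ⊎ (T (U v) → AllNbrs U v)
      high′ v with T? (U v)
      ... | no v∉U = inj₂ λ t → contradiction t v∉U
      ... | yes t  = Sum.map (t ,_) (λ all _ → all) (high v t)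
    -- With all degrees equal to 3, `U` is closed under adjacency; as it misses `x`, connectedness
    -- makes it empty.
    ...   | inj₂ all = empty F (λ v t → x∉U (spread (connected v x) t))
      where
      spread : ∀ {u w} → Star (Adj G) u w → T (U u) → T (U w)
      spread ε          t = t
      spread (uw ◅ p) t = spread p (all _ t _ uw)
    ...   | inj₁ (v , t , a , b , only@(_ , na , nb , _)) = cases (high a (proj₂ na)) (high b (proj₂ nb))
      where
      two : ∀ {w} → T (U w) → TwoNbrs U w
      two {w} t = [ (λ (_ , _ , o) → OnlyNbrs⇒Two {U} o) , AllNbrs⇒Two {U} ]′ (high w t)
      2≤v : 2 ≤ deg U v
      2≤v = 1<deg U (two t)
      cases : (∃ λ p → ∃ λ q → OnlyNbrs U a p q) ⊎ AllNbrs U a →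
              (∃ λ p → ∃ λ q → OnlyNbrs U b p q) ⊎ AllNbrs U b → Estimate U L
      cases (inj₂ all-a) (inj₂ all-b) = branch {L} 2 8 2 8 F t only
        (λ {L} F va → one-edge {L} 2 2 F t na va 2≤v (2<deg U all-a))
        (λ {L} F vb → one-edge {L} 2 2 F t nb vb 2≤v (2<deg U all-b))
        33-numeric
      -- Matching `v` to `b` forces a second edge at `a`, costing `4 + 4 + 4 = 12`; matching `v` to
      -- `a` costs only `4 + 2 = 6`. These are the branches `x^2` and `x`.
      cases (inj₁ (_ , _ , two-a)) (inj₂ all-b) = branch {L} 2 6 4 12 F t only
        (λ {L} F va → one-edge {L} 2 1 F t na va 2≤v (1<deg U (OnlyNbrs⇒Two {U} two-a)))
        (λ {L} F vb → two-edges {L} 2 two F t (OnlyNbrs-swap {U} only) two-a vb (2<deg U all-b))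
        23-numeric
      cases (inj₂ all-a) (inj₁ (_ , _ , two-b)) = branch {L} 4 12 2 6 F t only
        (λ {L} F va → two-edges {L} 2 two F t only two-b va (2<deg U all-a))
        (λ {L} F vb → one-edge {L} 2 1 F t nb vb 2≤v (1<deg U (OnlyNbrs⇒Two {U} two-b)))
        32-numeric
      -- Whichever neighbour is taken, the other one is left with a forced edge: `10 = 4 + 2 + 4`.
      cases (inj₁ (_ , _ , two-a)) (inj₁ (_ , _ , two-b)) = branch {L} 4 10 4 10 F t only
        (λ {L} F va → two-edges {L} 1 two F t only two-b va (1<deg U (OnlyNbrs⇒Two {U} two-a)))
        (λ {L} F vb → two-edges {L} 1 two F t (OnlyNbrs-swap {U} only) two-a vb (1<deg U (OnlyNbrs⇒Two {U} two-b)))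
        22-numeric

  estimate : ∀ {U L} → Proper U → Family U L → Estimate U L
  estimate {U} {L} = go (<-wellFounded (size U))
    where
    go : ∀ {U L} → Acc _<_ (size U) → Proper U → Family U L → Estimate U L
    go {U} {L} (acc rec) = step {U} (λ {U′} {L′} lt → go {U′} {L′} (rec lt)) {L}

-- Perfect matchings and their partner functions

lookup-injective : ∀ {A : Set} {xs : List A} → Unique xs → Injective _≡_ _≡_ (lookup xs)
lookup-injective (_ ∷ u) {zero}  {zero}  eq = refl
lookup-injective (x ∷ _) {zero}  {suc j} eq = contradiction eq (All.lookup x (∈-lookup j))
lookup-injective (x ∷ _) {suc i} {zero}  eq = contradiction (sym eq) (All.lookup x (∈-lookup i))
lookup-injective (_ ∷ u) {suc i} {suc j} eq = cong suc (lookup-injective u eq)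

subsets-unique : ∀ m → Unique (subsets m)
subsets-unique zero    = [] ∷ []
subsets-unique (suc m) = cartesianProductWith⁺ _∷_ ∷-injective
  (((λ ()) ∷ []) ∷ [] ∷ []) (subsets-unique m)

does⁺ : ∀ {A : Set} (a? : Dec A) → A → T (does a?)
does⁺ (yes _) _ = _
does⁺ (no ¬a) a = ¬a a

does⁻ : ∀ {A : Set} (a? : Dec A) → T (does a?) → A
does⁻ (yes a) _ = a

singleton-∃ : ∀ {n} (p : Subset n) → ∣ p ∣ ≡ 1 → ∃ λ x → x ∈ p
singleton-∃ p eq = _ , enum-∈ p (cast (sym eq) 0F)

singleton-unique : ∀ {n} (p : Subset n) → ∣ p ∣ ≡ 1 → ∀ {x y} → x ∈ p → y ∈ p → x ≡ y
singleton-unique p eq x∈p y∈p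
  with i , refl ← enum-surjective p x∈p | j , refl ← enum-surjective p y∈p =
  cong (enum p) (all-equal eq i j)
  where
  all-equal : ∀ {m} → m ≡ 1 → (i j : Fin m) → i ≡ j
  all-equal refl 0F 0F = refl

module PerfectMatchings {n} (G : Graph n) where
  open Graphs G

  edges-unique : Unique (edges G)
  edges-unique = Unique-filter⁺ _ (cartesianProduct⁺ (allFin⁺ n) (allFin⁺ n))

  edge-ends : ∀ e → let u , v = lookup (edges G) e in u Fin.< v × Adj G u v
  edge-ends e = proj₂ (∈-filter⁻ _ {xs = cartesianProduct (allFin n) (allFin n)} (∈-lookup e))

  Joins-sym : ∀ {e u v} → Joins G e u v → Joins G e v u
  Joins-sym = Sum.swap

  Joins⇒Adj : ∀ {e u v} → Joins G e u v → Adj G u v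
  Joins⇒Adj {e} (inj₁ p) = subst (λ (u , v) → Adj G u v) p (proj₂ (edge-ends e))
  Joins⇒Adj {e} (inj₂ p) = Adj-sym (subst (λ (u , v) → Adj G u v) p (proj₂ (edge-ends e)))

  Joins⇒Incident : ∀ {e u v} → Joins G e u v → Incident G u e
  Joins⇒Incident (inj₁ p) = inj₁ (sym (cong proj₁ p))
  Joins⇒Incident (inj₂ p) = inj₂ (sym (cong proj₂ p))

  Joins-injective : ∀ {e f u v} → Joins G e u v → Joins G f u v → e ≡ f
  Joins-injective {e} {f} = cases
    where
    ordered : ∀ {e u v} → lookup (edges G) e ≡ (u , v) → u Fin.< v
    ordered {e} p = subst (λ (u , v) → u Fin.< v) p (proj₁ (edge-ends e))
    cases : ∀ {u v} → Joins G e u v → Joins G f u v → e ≡ f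
    cases (inj₁ p) (inj₁ q) = lookup-injective edges-unique (trans p (sym q))
    cases (inj₂ p) (inj₂ q) = lookup-injective edges-unique (trans p (sym q))
    cases (inj₁ p) (inj₂ q) = contradiction (ordered {f} q) (ℕₚ.<-asym (ordered {e} p))
    cases (inj₂ p) (inj₁ q) = contradiction (ordered {f} q) (ℕₚ.<-asym (ordered {e} p))

  Joins-functional : ∀ {e u v w} → Joins G e u v → Joins G e u w → v ≡ w
  Joins-functional (inj₁ p) (inj₁ q) = cong proj₂ (trans (sym p) q)
  Joins-functional (inj₂ p) (inj₂ q) = cong proj₁ (trans (sym p) q)
  Joins-functional (inj₁ p) (inj₂ q) with refl ← trans (sym p) q = refl
  Joins-functional (inj₂ p) (inj₁ q) with refl ← trans (sym p) q = refl

  ∈-incidentEdges⁺ : ∀ {v e} → Incident G v e → e ∈ incidentEdges G v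
  ∈-incidentEdges⁺ {v} {e} i = ∈-tabulate⁺ _ (does⁺ (incident? G v e) i)

  ∈-incidentEdges⁻ : ∀ {v e} → e ∈ incidentEdges G v → Incident G v e
  ∈-incidentEdges⁻ {v} {e} m = does⁻ (incident? G v e) (∈-tabulate⁻ _ m)

  -- The value v is junk for an M that does not cover v.
  partner : EdgeSet G → Fin n → Fin n
  partner M v with any? (λ e → (e ∈? M) ×-dec incident? G v e)
  ... | yes (e , _ , inj₁ _) = proj₂ (lookup (edges G) e)
  ... | yes (e , _ , inj₂ _) = proj₁ (lookup (edges G) e)
  ... | no _                 = v

  partner-Joins : ∀ {M} → IsPerfectMatching G M → ∀ v → ∃ λ e → e ∈ M × Joins G e v (partner M v)
  partner-Joins {M} pm v with any? (λ e → (e ∈? M) ×-dec incident? G v e)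
  ... | yes (e , m , inj₁ p) = e , m , inj₁ (cong (_, _) (sym p))
  ... | yes (e , m , inj₂ p) = e , m , inj₂ (cong (_ ,_) (sym p))
  ... | no none =
    let e , m = singleton-∃ (M ∩ incidentEdges G v) (pm v)
        e∈M , e∈v = x∈p∩q⁻ M (incidentEdges G v) m
    in contradiction (e , e∈M , ∈-incidentEdges⁻ e∈v) none

  partner-unique : ∀ {M} → IsPerfectMatching G M → ∀ {e v w} → e ∈ M → Joins G e v w → partner M v ≡ w
  partner-unique {M} pm {e} {v} e∈M j
    with f , f∈M , k ← partner-Joins pm v
    with refl ← singleton-unique (M ∩ incidentEdges G v) (pm v)
      (x∈p∩q⁺ (e∈M , ∈-incidentEdges⁺ (Joins⇒Incident j)))
      (x∈p∩q⁺ (f∈M , ∈-incidentEdges⁺ (Joins⇒Incident k))) = Joins-functional k j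

  partner-adj : ∀ {M} → IsPerfectMatching G M → ∀ v → Adj G v (partner M v)
  partner-adj pm v = Joins⇒Adj (proj₂ (proj₂ (partner-Joins pm v)))

  partner-involutive : ∀ {M} → IsPerfectMatching G M → ∀ v → partner M (partner M v) ≡ v
  partner-involutive pm v = let e , e∈M , j = partner-Joins pm v in partner-unique pm e∈M (Joins-sym {e} j)

  -- For an edge of `M` with ends `u` and `v`, the edge of `N` at `u` also leads to `v`, and only
  -- one edge joins the two.
  partner-injective : ∀ {M N} → IsPerfectMatching G M → IsPerfectMatching G N →
    (∀ v → partner M v ≡ partner N v) → M ≡ N
  partner-injective pm pn eq = ⊆-antisym (⊆ pm pn eq) (⊆ pn pm (sym ∘ eq))
    where
    ⊆ : ∀ {M N} → IsPerfectMatching G M → IsPerfectMatching G N →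
      (∀ v → partner M v ≡ partner N v) → ∀ {e} → e ∈ M → e ∈ N
    ⊆ {M} {N} pm pn eq {e} e∈M =
      let u , v = lookup (edges G) e
          f , f∈N , k = partner-Joins pn u
          N-uv = trans (sym (eq u)) (partner-unique pm {e} e∈M (inj₁ refl))
      in subst (_∈ N) (Joins-injective {f} {e} (subst (Joins G f u) N-uv k) (inj₁ refl)) f∈N

-- From the exponential estimate to the final constant

^-distribʳ-* : ∀ k x y → (x * y) ^ k ≡ x ^ k * y ^ k
^-distribʳ-* zero    x y = refl
^-distribʳ-* (suc k) x y =
  trans (cong (x * y *_) (^-distribʳ-* k x y)) (ℕₚ.[m*n]*[o*p]≡[m*o]*[n*p] x y (x ^ k) (y ^ k))

-- The growth per vertex is `a / b` and the constant lost is `d / c`. After taking `k`-th powers,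
-- the slack of the first `t` factors absorbs the constant by `initial`, and each of the other
-- `n - t` is at most `N` by `rate`.
power-bound : ∀ k N {t n a b c d ℓ} .{{_ : NonZero b}} .{{_ : NonZero c}} → t ≤ n →
  a ^ k ≤ N * b ^ k → (a ^ k) ^ t * d ^ k ≤ (N * b ^ k) ^ t * c ^ k →
  ℓ * b ^ n * c ≤ a ^ n * d → ℓ ^ k ≤ N ^ n
power-bound k N {t} {a = a} {b} {c} {d} {ℓ} t≤n rate initial bound
  with j , refl ← ℕₚ.m≤n⇒∃[o]m+o≡n t≤n =
  ℕₚ.*-cancelʳ-≤ _ _ ((b ^ k) ^ (t + j) * c ^ k) {{nz}} (begin
    ℓ ^ k * ((b ^ k) ^ (t + j) * c ^ k)
      ≡⟨ trans (expand ℓ b) (ℕₚ.*-assoc (ℓ ^ k) _ _) ⟨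
    (ℓ * b ^ (t + j) * c) ^ k
      ≤⟨ ℕₚ.^-monoˡ-≤ k bound ⟩
    (a ^ (t + j) * d) ^ k
      ≡⟨ ^-distribʳ-* k (a ^ (t + j)) d ⟩
    (a ^ (t + j)) ^ k * d ^ k
      ≡⟨ cong (_* d ^ k) (trans (^-swap a) (ℕₚ.^-distribˡ-+-* (a ^ k) t j)) ⟩
    (a ^ k) ^ t * (a ^ k) ^ j * d ^ k
      ≡⟨ mid ((a ^ k) ^ t) ((a ^ k) ^ j) (d ^ k) ⟩
    (a ^ k) ^ t * d ^ k * (a ^ k) ^ j
      ≤⟨ ℕₚ.*-mono-≤ initial (ℕₚ.^-monoˡ-≤ j rate) ⟩
    (N * b ^ k) ^ t * c ^ k * (N * b ^ k) ^ j
      ≡⟨ mid ((N * b ^ k) ^ t) (c ^ k) ((N * b ^ k) ^ j) ⟩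
    (N * b ^ k) ^ t * (N * b ^ k) ^ j * c ^ k
      ≡⟨ cong (_* c ^ k) (ℕₚ.^-distribˡ-+-* (N * b ^ k) t j) ⟨
    (N * b ^ k) ^ (t + j) * c ^ k
      ≡⟨ cong (_* c ^ k) (^-distribʳ-* (t + j) N (b ^ k)) ⟩
    N ^ (t + j) * (b ^ k) ^ (t + j) * c ^ k
      ≡⟨ ℕₚ.*-assoc (N ^ (t + j)) _ _ ⟩
    N ^ (t + j) * ((b ^ k) ^ (t + j) * c ^ k) ∎)
  where
  open ℕₚ.≤-Reasoning
  nz : NonZero ((b ^ k) ^ (t + j) * c ^ k)
  nz = ℕₚ.m*n≢0 _ _ {{ℕₚ.m^n≢0 (b ^ k) (t + j) {{ℕₚ.m^n≢0 b k}}}} {{ℕₚ.m^n≢0 c k}}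
  ^-swap : ∀ x → (x ^ (t + j)) ^ k ≡ (x ^ k) ^ (t + j)
  ^-swap x = trans (ℕₚ.^-*-assoc x (t + j) k)
    (trans (cong (x ^_) (ℕₚ.*-comm (t + j) k)) (sym (ℕₚ.^-*-assoc x k (t + j))))
  expand : ∀ x y → (x * y ^ (t + j) * c) ^ k ≡ x ^ k * (y ^ k) ^ (t + j) * c ^ k
  expand x y = trans (^-distribʳ-* k (x * y ^ (t + j)) c)
    (cong (_* c ^ k) (trans (^-distribʳ-* k x (y ^ (t + j))) (cong (x ^ k *_) (^-swap y))))
  mid : ∀ x y z → x * y * z ≡ x * z * y
  mid = solve-∀

opaque
  unfolding up

  up-^ : ∀ s → up s (s * 3) ≡ up 1 3 ^ s
  up-^ s = trans (cong (λ x → 8 ^ s * 71 ^ x) (ℕₚ.*-comm s 3))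
    (trans (cong (8 ^ s *_) (sym (ℕₚ.^-*-assoc 71 3 s))) (sym (^-distribʳ-* s 8 (71 ^ 3))))

  down-^ : ∀ s → down s (s * 3) ≡ down 1 3 ^ s
  down-^ s = trans (cong (λ x → 9 ^ s * 63 ^ x) (ℕₚ.*-comm s 3))
    (trans (cong (9 ^ s *_) (sym (ℕₚ.^-*-assoc 63 3 s))) (sym (^-distribʳ-* s 9 (63 ^ 3))))

  down-nonZero : ∀ s e → NonZero (down s e)
  down-nonZero s e = ℕₚ.m*n≢0 (9 ^ s) (63 ^ e) {{ℕₚ.m^n≢0 9 s}} {{ℕₚ.m^n≢0 63 e}}

  rate-numeric : up 1 3 ^ 12 ≤ 20 * down 1 3 ^ 12
  rate-numeric = ℕₚ.≤ᵇ⇒≤ _ _ _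

  -- Twenty vertices gain a factor of about 1.19 over `20^(n/12)`, enough for the initial loss of
  -- about 1.149.
  initial-numeric : (up 1 3 ^ 12) ^ 20 * (down 2 10 + (down 2 10 + down 2 10)) ^ 12 ≤
    (20 * down 1 3 ^ 12) ^ 20 * up 2 10 ^ 12
  initial-numeric = ℕₚ.≤ᵇ⇒≤ _ _ _

final-bound : ∀ {n ℓ} → 20 ≤ n →
  ScaledBound n (n * 3) (up 2 10) (down 2 10 + (down 2 10 + down 2 10)) ℓ → ℓ ^ 12 ≤ 20 ^ n
final-bound {n} {ℓ} 20≤n b =
  power-bound 12 20 {b = down 1 3} {c = up 2 10} {ℓ = ℓ} {{down-nonZero 1 3}} {{up-nonZero 2 10}} 20≤n
    rate-numeric initial-numeric
    (subst₂ (λ x y → ℓ * x * up 2 10 ≤ y * (down 2 10 + (down 2 10 + down 2 10))) (down-^ n) (up-^ n) b)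

-- Counting in the whole graph

module Count {n} (G : Graph n) (cubic : Cubic G) (connected : Connected G)
  (tri : Graphs.TriangleFree G) (sq : Graphs.SquareFree G) (20≤n : 20 ≤ n) where
  open PerfectMatchings G
  open Neighbourhoods G cubic
  open Families G cubic connected tri sq (IsPerfectMatching G) partner partner-adj partner-involutive partner-injective

  matchings : List (EdgeSet G)
  matchings = filter (isPerfectMatching? G) (subsets (length (edges G)))

  full : Fin n → Bool
  full _ = true

  family : Family full matchings
  family = record
    { good   = λ m → proj₂ (∈-filter⁻ (isPerfectMatching? G) {xs = subsets _} m)
    ; unique = Unique-filter⁺ (isPerfectMatching? G) (subsets-unique _)
    ; closed = λ _ _ → _
    ; agree  = λ _ _ out → contradiction _ out
    }

  size-full : size full ≡ n
  size-full = trans (sum-const n 1) (ℕₚ.*-identityʳ n)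

  degreeSum-full : degreeSum full ≡ n * 3
  degreeSum-full = trans (sum-cong-≗ deg-full) (sum-const n 3)
    where
    deg-full : ∀ v → 1 * deg full v ≡ 3
    deg-full v = trans (ℕₚ.*-identityˡ _) (trans (sum-cong-≗ {n} (λ w → ℕₚ.*-identityˡ (bit (Graph.adj G v w))))
      (trans (sum-bit (Graph.adj G v)) (cubic v)))

  v : Fin n
  v = fromℕ< (ℕₚ.≤-trans (s≤s z≤n) 20≤n)

  -- The vertex `v` has degree 3 and its partner keeps degree 2, so the degree sum drops by
  -- `6 + 4 = 10`. The graph that remains is proper, and `estimate` applies to it.
  via : ∀ i {L} → Family full L → Matches L v (nb v i) → ScaledEstimate full 2 10 L
  via i {L} F m = one-edge {full} (λ _ → estimate) {L} 3 2 F _ (nb-adj v i , _) m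
    (2<deg full {v} _) (2<deg full {nb v i} _)

  total : ScaledBound (size full) (degreeSum full) (up 2 10) (down 2 10 + (down 2 10 + down 2 10)) (length matchings)
  total = Scaled-≤ {size full} {degreeSum full} split
    (Scaled-+ {size full} {degreeSum full} {ℓ₁ = length L₀} {ℓ₂ = length L₁ + length L₂}
      (via 0F {L₀} (family-filter (is 0F) family) (λ m → proj₂ (∈-filter⁻ (is 0F) {xs = matchings} m)))
      (Scaled-+ {size full} {degreeSum full} {ℓ₁ = length L₁} {ℓ₂ = length L₂}
        (via 1F {L₁} (family-filter (is 1F) family′) (λ m → proj₂ (∈-filter⁻ (is 1F) {xs = rest} m)))
        (via 2F {L₂} (family-filter (¬? ∘ is 1F) family′) last)))
    where
    is : ∀ i → Decidable (λ M → partner M v ≡ nb v i)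
    is i M = partner M v Fin.≟ nb v i
    L₀ = filter (is 0F) matchings
    rest = filter (¬? ∘ is 0F) matchings
    L₁ = filter (is 1F) rest
    L₂ = filter (¬? ∘ is 1F) rest
    family′ : Family full rest
    family′ = family-filter (¬? ∘ is 0F) family
    split : length matchings ≤ length L₀ + (length L₁ + length L₂)
    split = ℕₚ.≤-trans (length≤filter+filter (is 0F) matchings)
      (ℕₚ.+-monoʳ-≤ (length L₀) (length≤filter+filter (is 1F) rest))
    last : Matches L₂ v (nb v 2F)
    last {M} m with m′ , ≢1 ← ∈-filter⁻ (¬? ∘ is 1F) {xs = rest} m
               with m″ , ≢0 ← ∈-filter⁻ (¬? ∘ is 0F) {xs = matchings} m′
               with nb-surjective (partner-adj (Family.good family m″) v)
    ... | 0F , eq = contradiction (sym eq) ≢0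
    ... | 1F , eq = contradiction (sym eq) ≢1
    ... | 2F , eq = sym eq

  count : length matchings ^ 12 ≤ 20 ^ n
  count = final-bound {n} {length matchings} 20≤n
    (subst₂ (λ s e → ScaledBound s e (up 2 10) (down 2 10 + (down 2 10 + down 2 10)) (length matchings))
      size-full degreeSum-full total)

mainTheorem11 : ∀ (n : ℕ) (G : Graph n) → IsFullerene G →
    ∃ (λ S → IsNontrivialCyclic5EdgeCut G S) →
    numPerfectMatchings G ^ 12 ≤ 20 ^ n
mainTheorem11 n G (cubic , E , bounded) _ =
  Count.count G cubic (PlaneEmbedding.connected E) triangle-free square-free 20≤n
  where open Fullerenes G cubic E bounded
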